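{- Let $\Delta$ be of type $C_n$ and let $\mathfrak{Ab}$ be its poset of abelian ideals. Then $\mathcal K^{u}_{\mathfrak{Ab}}(q)=\mathcal K^{l}_{\mathfrak{Ab}}(q)=\sum_{k\ge0}\binom{n+1}{2k}q^k$.
   Context: Type $C_n$: positive roots $\Delta^+=\{\varepsilon_i\pm\varepsilon_j\ (1\le i<j\le n),\ 2\varepsilon_i\ (1\le i\le n)\}$, simple roots $\varepsilon_i-\varepsilon_{i+1}$ ($i<n$), $2\varepsilon_n$, with the root order (generated by $\gamma$ covering $\mu$ iff $\gamma-\mu$ is a simple root). An upper ideal $I\subset\Delta^+$ (up-closed subset) is abelian if $\gamma'+\gamma''\notin\Delta^+$ for all $\gamma',\gamma''\in I$; $\mathfrak{Ab}$ is the poset of all abelian upper ideals (including $\varnothing$) ordered by inclusion. For a finite poset, $\kappa(x)$ (resp. $\iota(x)$) is the number of elements covered by (resp. covering) $x$; $\mathcal K^{u}=\sum_x q^{\kappa(x)}$, $\mathcal K^{l}=\sum_x q^{\iota(x)}$. -}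

module Defs where

open import Data.Bool using (Bool; true; false; T?; _∧_; _∨_; not; if_then_else_)
open import Data.Nat using (ℕ; zero; suc; _≡ᵇ_; _<ᵇ_)
open import Data.Integer as ℤ using (ℤ; +_)
open import Data.Fin using (Fin; toℕ)
open import Data.Fin.Properties using () renaming (_≟_ to _≟F_)
open import Data.List using (List; []; _∷_; _++_; length; filter; concatMap; map; allFin; lookup)
open import Data.Bool.ListAction using (any; all)
open import Data.Vec as V using (Vec; []; _∷_)
import Data.Vec.Properties as VP
open import Relation.Nullary.Decidable using (⌊_⌋)
open import Relation.Unary using (Pred; Decidable)
open import Relation.Binary.PropositionalEquality using (_≡_)

-- Weight-lattice vectors: coordinates w.r.t. ε₁,…,εₙ.
Wt : ℕ → Set
Wt n = Vec ℤ n

_==ʷ_ : ∀ {n} → Wt n → Wt n → Bool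
u ==ʷ v = ⌊ VP.≡-dec ℤ._≟_ u v ⌋

_+ʷ_ : ∀ {n} → Wt n → Wt n → Wt n
u +ʷ v = V.zipWith ℤ._+_ u v

_-ʷ_ : ∀ {n} → Wt n → Wt n → Wt n
u -ʷ v = V.zipWith ℤ._-_ u v

scaledUnit : ∀ {n} → ℤ → Fin n → Wt n
scaledUnit c i = V.tabulate (λ k → if ⌊ k ≟F i ⌋ then c else + 0)

ε : ∀ {n} → Fin n → Wt n
ε = scaledUnit (+ 1)

posRoots : (n : ℕ) → List (Wt n)
posRoots n =
  concatMap (λ i → concatMap (λ j →
      if toℕ i <ᵇ toℕ j then (ε i -ʷ ε j) ∷ (ε i +ʷ ε j) ∷ [] else [])
    (allFin n)) (allFin n)
  ++ map (scaledUnit (+ 2)) (allFin n)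

simpleRoots : (n : ℕ) → List (Wt n)
simpleRoots n =
  concatMap (λ i → concatMap (λ j →
      if suc (toℕ i) ≡ᵇ toℕ j then (ε i -ʷ ε j) ∷ [] else [])
    (allFin n)) (allFin n)
  ++ concatMap (λ i → if suc (toℕ i) ≡ᵇ n then scaledUnit (+ 2) i ∷ [] else []) (allFin n)

isPosRoot : ∀ {n} → Wt n → Bool
isPosRoot {n} v = any (v ==ʷ_) (posRoots n)

coversRoot : ∀ {n} → Wt n → Wt n → Bool
coversRoot {n} γ μ = any ((γ -ʷ μ) ==ʷ_) (simpleRoots n)

N : ℕ → ℕ
N n = length (posRoots n)

root : ∀ n → Fin (N n) → Wt n
root n = lookup (posRoots n)

SubΔ : ℕ → Set
SubΔ n = Vec Bool (N n)

allVecs : (m : ℕ) → List (Vec Bool m)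
allVecs zero = [] ∷ []
allVecs (suc m) = concatMap (λ v → (false ∷ v) ∷ (true ∷ v) ∷ []) (allVecs m)

mem : ∀ n → Fin (N n) → SubΔ n → Bool
mem n i S = V.lookup S i

_⇒ᵇ_ : Bool → Bool → Bool
a ⇒ᵇ b = not a ∨ b

-- Upper ideal: closed upward under the generating covering relation of the root order
isUpperIdeal : ∀ n → SubΔ n → Bool
isUpperIdeal n S =
  all (λ i → all (λ j → (mem n i S ∧ coversRoot (root n j) (root n i)) ⇒ᵇ mem n j S)
    (allFin (N n))) (allFin (N n))

isAbelian : ∀ n → SubΔ n → Bool
isAbelian n S =
  all (λ i → all (λ j → (mem n i S ∧ mem n j S) ⇒ᵇ not (isPosRoot (root n i +ʷ root n j)))
    (allFin (N n))) (allFin (N n))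

countᵇ : ∀ {A : Set} → (A → Bool) → List A → ℕ
countᵇ p xs = length (filter (λ x → T? (p x)) xs)

-- The poset 𝔄𝔟 of abelian upper ideals (including ∅), ordered by inclusion
Ab : (n : ℕ) → List (SubΔ n)
Ab n = filter (λ S → T? (isUpperIdeal n S ∧ isAbelian n S)) (allVecs (N n))

incl : ∀ n → SubΔ n → SubΔ n → Bool
incl n S T = all (λ i → mem n i S ⇒ᵇ mem n i T) (allFin (N n))

strictIncl : ∀ n → SubΔ n → SubΔ n → Bool
strictIncl n S T = incl n S T ∧ not (incl n T S)

coveredBy : ∀ n → SubΔ n → SubΔ n → Bool
coveredBy n y x = strictIncl n y x ∧ not (any (λ z → strictIncl n y z ∧ strictIncl n z x) (Ab n))

κ : ∀ n → SubΔ n → ℕ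
κ n x = countᵇ (λ y → coveredBy n y x) (Ab n)

ι : ∀ n → SubΔ n → ℕ
ι n x = countᵇ (λ y → coveredBy n x y) (Ab n)

-- Coefficient of q^k in 𝒦ᵘ = Σ_x q^κ(x), resp. 𝒦ˡ = Σ_x q^ι(x)
Kᵘ-coeff : ℕ → ℕ → ℕ
Kᵘ-coeff n k = countᵇ (λ x → κ n x ≡ᵇ k) (Ab n)

Kˡ-coeff : ℕ → ℕ → ℕ
Kˡ-coeff n k = countᵇ (λ x → ι n x ≡ᵇ k) (Ab n)

{-# OPTIONS --safe #-}
-- An abelian ideal contains no εᵢ − εⱼ, since with it it contains εᵢ − εₙ and εᵢ + εₙ, whose sum is 2εᵢ.
-- So abelian ideals are the upper ideals of the triangle {εᵢ + εⱼ : i ≤ j}. Counting the roots of an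
-- ideal on each diagonal j − i = n − m gives the heights of a 0/1 lattice path of length n, and inclusion
-- of ideals becomes pointwise order of heights. There covers are the moves 10 ↦ 01 anywhere and 1 ↦ 0
-- at the end of the path, so κ counts the maximal runs of 1 and, by complementation, ι those of 0.
-- The paths with k runs of 1 satisfy Pascal's recursion for C(n+1, 2k).
module Submission where

open import Defs
open import Data.Nat using (ℕ; suc; _*_; _≤_)
open import Data.Nat.Combinatorics using (_C_)
open import Data.Product using (_×_)
open import Relation.Binary.PropositionalEquality using (_≡_)

open import Algebra.Bundles using (AbelianGroup)
open import Data.Bool using (Bool; true; false; T; T?; not; _∧_; if_then_else_)
open import Data.Bool.ListAction using (any; all)
import Data.Bool.Properties as Bool
open import Data.Empty using (⊥-elim)
open import Data.Fin using (Fin; zero; suc; toℕ; fromℕ<)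
open import Data.Fin.Properties using (any?; toℕ<n; toℕ-fromℕ<; toℕ-injective) renaming (_≟_ to _≟F_)
open import Data.Integer as ℤ using (ℤ; +_)
import Data.Integer.Properties as ℤ
open import Data.Integer.Tactic.RingSolver using (solve-∀)
open import Data.List as L using (List; []; _∷_; concatMap; allFin)
open import Data.List.Membership.Propositional using (_∈_; find; lose)
open import Data.List.Membership.Propositional.Properties
  using (∈-concatMap⁺; ∈-concatMap⁻; ∈-++⁺ˡ; ∈-++⁺ʳ; ∈-++⁻; ∈-map⁺; ∈-map⁻; ∈-allFin; ∈-lookup; ∈-filter⁺; ∈-filter⁻)
open import Data.List.Membership.Propositional.Properties.WithK using (unique∧set⇒bag)
open import Data.List.Relation.Binary.BagAndSetEquality using (∼bag⇒↭)
open import Data.List.Relation.Binary.Permutation.Propositional using (_↭_)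
open import Data.List.Relation.Binary.Permutation.Propositional.Properties using (filter-↭; ↭-length)
import Data.List.Relation.Unary.All as All
import Data.List.Relation.Unary.All.Properties as All
import Data.List.Relation.Unary.AllPairs as AllPairs
import Data.List.Relation.Unary.AllPairs.Properties as AllPairs
open import Data.List.Relation.Unary.Any as Any using (here; there)
open import Data.List.Relation.Unary.Any.Properties using (any⁺; any⁻; lookup-index)
open import Data.List.Relation.Unary.Unique.Propositional using (Unique; []; _∷_)
import Data.List.Relation.Unary.Unique.Propositional.Properties as Unique
open import Data.Nat
open import Data.Nat.Combinatorics using (nCk+nC[k+1]≡[n+1]C[k+1]; k>n⇒nCk≡0)
open import Data.Nat.Properties
open import Data.Product using (_,_; ∃; proj₁; proj₂)
open import Data.Sum as Sum using (_⊎_; inj₁; inj₂)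
open import Data.Vec as V using (Vec; []; _∷_)
import Data.Vec.Properties as V
open import Function using (_∘_; _⇔_; mk⇔; Equivalence)
open import Relation.Binary.PropositionalEquality
open import Relation.Nullary using (¬_; yes; no; Dec)
open import Relation.Nullary.Decidable using (⌊_⌋; toWitness; fromWitness; _×-dec_)

-- The binomial coefficient can be read off the paths directly. With a 0 added at either end, a path
-- of length n has n + 1 places where the letter may change, and k runs of 1 mean exactly 2k
-- changes. Pascal's recursion needs the odd coefficients too; these count the paths preceded by a
-- 1. Heights form a 0/1 path because the two ways of adding a simple root to εᵢ + εⱼ bound the
-- increment from one diagonal to the next, one from below by 0 and the other from above by 1. The
-- obstacle is the encoding: ideals are Boolean vectors indexed by positions in a list of integer
-- vectors. Each positive root therefore gets a unique label, and the sum of the coordinates, which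
-- is 0 on εᵢ - εⱼ and 2 on εᵢ + εⱼ, rules out most of the unwanted sums of roots.

-- Counting over lists of Boolean vectors

T-ext : ∀ {x y} → (T x → T y) → (T y → T x) → x ≡ y
T-ext {false} {false} f g = refl
T-ext {true}  {true}  f g = refl
T-ext {false} {true}  f g = ⊥-elim (g _)
T-ext {true}  {false} f g = ⊥-elim (f _)

module _ {A : Set} where

  countᵇ-cong : ∀ {p q : A → Bool} → (∀ x → p x ≡ q x) → ∀ xs → countᵇ p xs ≡ countᵇ q xs
  countᵇ-cong p≗q [] = refl
  countᵇ-cong {p} {q} p≗q (x ∷ xs) with p x | q x | p≗q x
  ... | true  | .true  | refl = cong suc (countᵇ-cong p≗q xs)
  ... | false | .false | refl = countᵇ-cong p≗q xs

  countᵇ-false : ∀ (xs : List A) → countᵇ (λ _ → false) xs ≡ 0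
  countᵇ-false []       = refl
  countᵇ-false (x ∷ xs) = countᵇ-false xs

  countᵇ-map : ∀ {B : Set} (p : B → Bool) (f : A → B) xs → countᵇ p (L.map f xs) ≡ countᵇ (p ∘ f) xs
  countᵇ-map p f [] = refl
  countᵇ-map p f (x ∷ xs) with p (f x)
  ... | true  = cong suc (countᵇ-map p f xs)
  ... | false = countᵇ-map p f xs

countᵇ-allVecs-suc : ∀ {n} (p : Vec Bool (suc n) → Bool) →
  countᵇ p (allVecs (suc n)) ≡ countᵇ (p ∘ (false ∷_)) (allVecs n) + countᵇ (p ∘ (true ∷_)) (allVecs n)
countᵇ-allVecs-suc {n} p = go (allVecs n)
  where
  go : ∀ xs → countᵇ p (concatMap (λ v → (false ∷ v) ∷ (true ∷ v) ∷ []) xs)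
            ≡ countᵇ (p ∘ (false ∷_)) xs + countᵇ (p ∘ (true ∷_)) xs
  go [] = refl
  go (x ∷ xs) with p (false ∷ x)
  go (x ∷ xs) | true with p (true ∷ x)
  ... | true  = cong suc (trans (cong suc (go xs)) (sym (+-suc _ _)))
  ... | false = cong suc (go xs)
  go (x ∷ xs) | false with p (true ∷ x)
  ... | true  = trans (cong suc (go xs)) (sym (+-suc _ _))
  ... | false = go xs

countᵇ-allVecs-not : ∀ n (p : Vec Bool n → Bool) → countᵇ p (allVecs n) ≡ countᵇ (p ∘ V.map not) (allVecs n)
countᵇ-allVecs-not zero p with p []
... | true  = refl
... | false = refl
countᵇ-allVecs-not (suc n) p = begin
  countᵇ p (allVecs (suc n))
    ≡⟨ countᵇ-allVecs-suc p ⟩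
  countᵇ (p ∘ (false ∷_)) (allVecs n) + countᵇ (p ∘ (true ∷_)) (allVecs n)
    ≡⟨ cong₂ _+_ (countᵇ-allVecs-not n _) (countᵇ-allVecs-not n _) ⟩
  countᵇ (p ∘ (false ∷_) ∘ V.map not) (allVecs n) + countᵇ (p ∘ (true ∷_) ∘ V.map not) (allVecs n)
    ≡⟨ +-comm (countᵇ (p ∘ (false ∷_) ∘ V.map not) (allVecs n)) _ ⟩
  countᵇ (p ∘ (true ∷_) ∘ V.map not) (allVecs n) + countᵇ (p ∘ (false ∷_) ∘ V.map not) (allVecs n)
    ≡⟨ countᵇ-allVecs-suc (p ∘ V.map not) ⟨
  countᵇ (p ∘ V.map not) (allVecs (suc n)) ∎
  where open ≡-Reasoning

-- Heights of 0/1 paths and their pointwise order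

bit : Bool → ℕ
bit false = 0
bit true  = 1

bit≤1 : ∀ x → bit x ≤ 1
bit≤1 false = z≤n
bit≤1 true  = s≤s z≤n

-- The number of 1 among the first `m` entries. It stays constant past the end, so `_⊑_` can compare
-- heights at all `m` without a bound.
height : ∀ {n} → Vec Bool n → ℕ → ℕ
height []      m       = 0
height (x ∷ b) zero    = 0
height (x ∷ b) (suc m) = bit x + height b m

height-zero : ∀ {n} (b : Vec Bool n) → height b 0 ≡ 0
height-zero []      = refl
height-zero (x ∷ b) = refl

height≤ : ∀ {n} (b : Vec Bool n) m → height b m ≤ m
height≤ []      m       = z≤n
height≤ (x ∷ b) zero    = z≤n
height≤ (x ∷ b) (suc m) = +-mono-≤ (bit≤1 x) (height≤ b m)

height-mono-suc : ∀ {n} (b : Vec Bool n) m → height b m ≤ height b (suc m)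
height-mono-suc []      m       = z≤n
height-mono-suc (x ∷ b) zero    = z≤n
height-mono-suc (x ∷ b) (suc m) = +-monoʳ-≤ (bit x) (height-mono-suc b m)

height-suc≤ : ∀ {n} (b : Vec Bool n) m → height b (suc m) ≤ suc (height b m)
height-suc≤ []      m       = z≤n
height-suc≤ (x ∷ b) zero rewrite height-zero b | +-identityʳ (bit x) = bit≤1 x
height-suc≤ (x ∷ b) (suc m) = ≤-trans (+-monoʳ-≤ (bit x) (height-suc≤ b m)) (≤-reflexive (+-suc (bit x) _))

infix 4 _⊑_
_⊑_ : ∀ {n} → Vec Bool n → Vec Bool n → Set
c ⊑ b = ∀ m → height c m ≤ height b m

∷⁺-⊑ : ∀ {n} x {c b : Vec Bool n} → c ⊑ b → x ∷ c ⊑ x ∷ b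
∷⁺-⊑ x c⊑b zero    = z≤n
∷⁺-⊑ x c⊑b (suc m) = +-monoʳ-≤ (bit x) (c⊑b m)

∷⁻-⊑ : ∀ {n} x {c b : Vec Bool n} → x ∷ c ⊑ x ∷ b → c ⊑ b
∷⁻-⊑ x c⊑b m = +-cancelˡ-≤ (bit x) _ _ (c⊑b (suc m))

true⋢false : ∀ {n} {c b : Vec Bool n} → ¬ true ∷ c ⊑ false ∷ b
true⋢false {c = c} {b} c⊑b with c⊑b 1
... | 1≤ rewrite height-zero c | height-zero b = n≮0 1≤

⊑-antisym : ∀ {n} {c b : Vec Bool n} → c ⊑ b → b ⊑ c → c ≡ b
⊑-antisym {c = []} {[]} _ _ = refl
⊑-antisym {c = false ∷ c} {false ∷ b} c⊑b b⊑c = cong (false ∷_) (⊑-antisym (∷⁻-⊑ false c⊑b) (∷⁻-⊑ false b⊑c))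
⊑-antisym {c = true  ∷ c} {true  ∷ b} c⊑b b⊑c = cong (true ∷_) (⊑-antisym (∷⁻-⊑ true c⊑b) (∷⁻-⊑ true b⊑c))
⊑-antisym {c = false ∷ c} {true  ∷ b} c⊑b b⊑c = ⊥-elim (true⋢false b⊑c)
⊑-antisym {c = true  ∷ c} {false ∷ b} c⊑b b⊑c = ⊥-elim (true⋢false c⊑b)

-- Covers of paths

eqVec : ∀ {n} → Vec Bool n → Vec Bool n → Bool
eqVec []          []          = true
eqVec (false ∷ c) (false ∷ b) = eqVec c b
eqVec (true  ∷ c) (true  ∷ b) = eqVec c b
eqVec (false ∷ c) (true  ∷ b) = false
eqVec (true  ∷ c) (false ∷ b) = false

eqVec⇒≡ : ∀ {n} (c b : Vec Bool n) → T (eqVec c b) → c ≡ b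
eqVec⇒≡ []          []          _ = refl
eqVec⇒≡ (false ∷ c) (false ∷ b) t = cong (false ∷_) (eqVec⇒≡ c b t)
eqVec⇒≡ (true  ∷ c) (true  ∷ b) t = cong (true ∷_) (eqVec⇒≡ c b t)

eqVec-refl : ∀ {n} (b : Vec Bool n) → T (eqVec b b)
eqVec-refl []          = _
eqVec-refl (false ∷ b) = eqVec-refl b
eqVec-refl (true  ∷ b) = eqVec-refl b

-- Lowering the head of true ∷ b to false is compensated by raising the next entry, if there is one.
carry : ∀ {n} → Vec Bool n → Vec Bool n → Bool
carry []          []          = true
carry (true  ∷ c) (false ∷ b) = eqVec c b
carry (false ∷ _) (_     ∷ _) = false
carry (true  ∷ _) (true  ∷ _) = false

cov : ∀ {n} → Vec Bool n → Vec Bool n → Bool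
cov []          []          = false
cov (false ∷ c) (false ∷ b) = cov c b
cov (true  ∷ c) (true  ∷ b) = cov c b
cov (true  ∷ c) (false ∷ b) = false
cov (false ∷ c) (true  ∷ b) = carry c b

carry⇒⊑ : ∀ {n} (c b : Vec Bool n) → T (carry c b) → false ∷ c ⊑ true ∷ b
carry⇒⊑ []          []          t zero          = z≤n
carry⇒⊑ []          []          t (suc m)       = z≤n
carry⇒⊑ (true ∷ c)  (false ∷ b) t zero          = z≤n
carry⇒⊑ (true ∷ c)  (false ∷ b) t (suc zero)    = z≤n
carry⇒⊑ (true ∷ c)  (false ∷ b) t (suc (suc m)) rewrite eqVec⇒≡ c b t = ≤-refl

cov⇒⊑ : ∀ {n} (c b : Vec Bool n) → T (cov c b) → c ⊑ b
cov⇒⊑ []          []          ()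
cov⇒⊑ (false ∷ c) (false ∷ b) t = ∷⁺-⊑ false (cov⇒⊑ c b t)
cov⇒⊑ (true  ∷ c) (true  ∷ b) t = ∷⁺-⊑ true (cov⇒⊑ c b t)
cov⇒⊑ (false ∷ c) (true  ∷ b) t = carry⇒⊑ c b t

cov⇒≢ : ∀ {n} (c b : Vec Bool n) → T (cov c b) → c ≢ b
cov⇒≢ (false ∷ c) (.false ∷ .c) t refl = cov⇒≢ c c t refl
cov⇒≢ (true  ∷ c) (.true  ∷ .c) t refl = cov⇒≢ c c t refl

-- After the common prefix, `z` lies between 01x and 10x. It cannot start with 00 or 11, since its
-- height after two entries must be 1. Past these two entries its heights are squeezed between those
-- of x, so x is its tail. At the end of the path only one entry is left to choose.
cov-between : ∀ {n} (c b z : Vec Bool n) → T (cov c b) → c ⊑ z → z ⊑ b → z ≡ c ⊎ z ≡ b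
cov-between [] [] z ()
cov-between (false ∷ c) (false ∷ b) (false ∷ z) t c⊑z z⊑b =
  Sum.map (cong (false ∷_)) (cong (false ∷_)) (cov-between c b z t (∷⁻-⊑ false c⊑z) (∷⁻-⊑ false z⊑b))
cov-between (true ∷ c) (true ∷ b) (true ∷ z) t c⊑z z⊑b =
  Sum.map (cong (true ∷_)) (cong (true ∷_)) (cov-between c b z t (∷⁻-⊑ true c⊑z) (∷⁻-⊑ true z⊑b))
cov-between (true ∷ c) _ (false ∷ z) t c⊑z z⊑b = ⊥-elim (true⋢false c⊑z)
cov-between _ (false ∷ b) (true ∷ z) t c⊑z z⊑b = ⊥-elim (true⋢false z⊑b)
cov-between (false ∷ []) (true ∷ []) (false ∷ []) t c⊑z z⊑b = inj₁ refl
cov-between (false ∷ []) (true ∷ []) (true ∷ [])  t c⊑z z⊑b = inj₂ refl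
cov-between (false ∷ true ∷ c) (true ∷ false ∷ b) (false ∷ false ∷ z) t c⊑z z⊑b =
  ⊥-elim (true⋢false (∷⁻-⊑ false c⊑z))
cov-between (false ∷ true ∷ c) (true ∷ false ∷ b) (false ∷ true ∷ z) t c⊑z z⊑b
  with refl ← eqVec⇒≡ c b t =
  inj₁ (cong (λ v → false ∷ true ∷ v) (⊑-antisym (λ m → ≤-pred (z⊑b (suc (suc m)))) (∷⁻-⊑ true (∷⁻-⊑ false c⊑z))))
cov-between (false ∷ true ∷ c) (true ∷ false ∷ b) (true ∷ false ∷ z) t c⊑z z⊑b
  with refl ← eqVec⇒≡ c b t =
  inj₂ (cong (λ v → true ∷ false ∷ v) (⊑-antisym (∷⁻-⊑ false (∷⁻-⊑ true z⊑b)) (λ m → ≤-pred (c⊑z (suc (suc m))))))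
cov-between (false ∷ true ∷ c) (true ∷ false ∷ b) (true ∷ true ∷ z) t c⊑z z⊑b =
  ⊥-elim (true⋢false (∷⁻-⊑ true z⊑b))

-- Passing an entry `true` of b against `w` of c changes the lead from `s` to `suc s ∸ bit w`; the
-- hypothesis keeps the subtraction from truncating.
lead : ∀ {s w h} → bit w ≤ s → s + suc h ≡ bit w + (suc s ∸ bit w + h)
lead {s} {w} {h} w≤s = trans (+-suc s h) (trans (cong (_+ h) (sym (m+[n∸m]≡n (m≤n⇒m≤1+n w≤s)))) (+-assoc (bit w) _ h))

-- s is the lead that b has already gained over c on the preceding entries.
descend : ∀ {n} s w (c b : Vec Bool n) → bit w ≤ s →
  (∀ m → height (w ∷ c) m ≤ s + height (true ∷ b) m) →
  ∃ λ z → T (cov z (true ∷ b)) × (∀ m → height (w ∷ c) m ≤ s + height z m)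
descend s w [] [] w≤s h = (false ∷ []) , _ , λ
  { zero    → z≤n
  ; (suc m) → +-mono-≤ w≤s z≤n }
descend s w (x ∷ c) (false ∷ b) w≤s h = (false ∷ true ∷ b) , eqVec-refl b , λ
  { zero          → z≤n
  ; (suc zero)    → ≤-trans (≤-reflexive (+-identityʳ _)) (≤-trans w≤s (m≤m+n s 0))
  ; (suc (suc m)) → h (suc (suc m)) }
descend s w (x ∷ c) (true ∷ b) w≤s h
  with z , z⋖ , le ← descend (suc s ∸ bit w) x c b
       (≤-trans (bit≤1 x) (m<n⇒0<n∸m (s≤s w≤s)))
       (λ m → +-cancelˡ-≤ (bit w) _ _ (≤-trans (h (suc m)) (≤-reflexive (lead w≤s))))
  = (true ∷ z) , z⋖ , λ
  { zero    → z≤n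
  ; (suc m) → ≤-trans (+-monoʳ-≤ (bit w) (le m)) (≤-reflexive (sym (lead w≤s))) }

-- The first difference is a 0 of `c` against a 1 of `b`. While the run of 1 in `b` lasts, its lead
-- over `c` stays at least 1. The move at the end of that run costs one unit of height, so it does
-- not fall below `c`.
⊏⇒cov : ∀ {n} (c b : Vec Bool n) → c ⊑ b → c ≢ b → ∃ λ z → T (cov z b) × c ⊑ z
⊏⇒cov [] [] c⊑b c≢b = ⊥-elim (c≢b refl)
⊏⇒cov (false ∷ c) (false ∷ b) c⊑b c≢b
  with z , z⋖ , le ← ⊏⇒cov c b (∷⁻-⊑ false c⊑b) (c≢b ∘ cong (false ∷_)) = (false ∷ z) , z⋖ , ∷⁺-⊑ false le
⊏⇒cov (true ∷ c) (true ∷ b) c⊑b c≢b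
  with z , z⋖ , le ← ⊏⇒cov c b (∷⁻-⊑ true c⊑b) (c≢b ∘ cong (true ∷_)) = (true ∷ z) , z⋖ , ∷⁺-⊑ true le
⊏⇒cov (false ∷ c) (true ∷ b) c⊑b c≢b = descend 0 false c b z≤n c⊑b
⊏⇒cov (true ∷ c) (false ∷ b) c⊑b c≢b = ⊥-elim (true⋢false c⊑b)

-- Numbers of covers as numbers of runs

-- Each run is counted at its right end, the place where `cov` makes its move.
runs : ∀ {n} → Vec Bool n → ℕ
runs []                = 0
runs (false ∷ b)       = runs b
runs (true ∷ [])       = 1
runs (true ∷ false ∷ b) = suc (runs b)
runs (true ∷ true ∷ b) = runs (true ∷ b)

countᵇ-eqVec : ∀ {n} (b : Vec Bool n) → countᵇ (λ c → eqVec c b) (allVecs n) ≡ 1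
countᵇ-eqVec [] = refl
countᵇ-eqVec {suc n} (false ∷ b) = trans (countᵇ-allVecs-suc (λ c → eqVec c (false ∷ b))) (cong₂ _+_ (countᵇ-eqVec b) (countᵇ-false (allVecs n)))
countᵇ-eqVec {suc n} (true ∷ b) = trans (countᵇ-allVecs-suc (λ c → eqVec c (true ∷ b))) (cong₂ _+_ (countᵇ-false (allVecs n)) (countᵇ-eqVec b))

-- Split by the head of `c`. Under a head `true` of `b`, the vectors with head `false` are counted
-- by `carry`, which gives 1 if the run ends at this entry and 0 if it goes on.
countᵇ-cov : ∀ {n} (b : Vec Bool n) → countᵇ (λ c → cov c b) (allVecs n) ≡ runs b
countᵇ-cov [] = refl
countᵇ-cov {suc n} (false ∷ b) = trans (countᵇ-allVecs-suc (λ c → cov c (false ∷ b)))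
  (trans (cong₂ _+_ (countᵇ-cov b) (countᵇ-false (allVecs n))) (+-identityʳ _))
countᵇ-cov (true ∷ []) = refl
countᵇ-cov {suc (suc n)} (true ∷ false ∷ b) = trans (countᵇ-allVecs-suc (λ c → cov c (true ∷ false ∷ b)))
  (cong₂ _+_ (trans (countᵇ-allVecs-suc (λ c → carry c (false ∷ b))) (cong₂ _+_ (countᵇ-false (allVecs n)) (countᵇ-eqVec b)))
             (countᵇ-cov (false ∷ b)))
countᵇ-cov {suc (suc n)} (true ∷ true ∷ b) = trans (countᵇ-allVecs-suc (λ c → cov c (true ∷ true ∷ b)))
  (cong₂ _+_ (trans (countᵇ-allVecs-suc (λ c → carry c (true ∷ b))) (cong₂ _+_ (countᵇ-false (allVecs n)) (countᵇ-false (allVecs n))))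
             (countᵇ-cov (true ∷ b)))

eqVec-not : ∀ {n} (c b : Vec Bool n) → eqVec c b ≡ eqVec (V.map not b) (V.map not c)
eqVec-not []          []          = refl
eqVec-not (false ∷ c) (false ∷ b) = eqVec-not c b
eqVec-not (false ∷ c) (true  ∷ b) = refl
eqVec-not (true  ∷ c) (false ∷ b) = refl
eqVec-not (true  ∷ c) (true  ∷ b) = eqVec-not c b

carry-not : ∀ {n} (c b : Vec Bool n) → carry c b ≡ carry (V.map not b) (V.map not c)
carry-not []          []          = refl
carry-not (false ∷ c) (false ∷ b) = refl
carry-not (false ∷ c) (true  ∷ b) = refl
carry-not (true  ∷ c) (false ∷ b) = eqVec-not c b
carry-not (true  ∷ c) (true  ∷ b) = refl

-- Complementing all entries turns the move 10 ↦ 01 into 01 ↦ 10, the same move read upwards, and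
-- likewise for 1 ↦ 0 at the end.
cov-not : ∀ {n} (c b : Vec Bool n) → cov c b ≡ cov (V.map not b) (V.map not c)
cov-not []          []          = refl
cov-not (false ∷ c) (false ∷ b) = cov-not c b
cov-not (false ∷ c) (true  ∷ b) = carry-not c b
cov-not (true  ∷ c) (false ∷ b) = refl
cov-not (true  ∷ c) (true  ∷ b) = cov-not c b

countᵇ-cov-above : ∀ {n} (c : Vec Bool n) → countᵇ (λ b → cov c b) (allVecs n) ≡ runs (V.map not c)
countᵇ-cov-above {n} c = begin
  countᵇ (λ b → cov c b) (allVecs n)
    ≡⟨ countᵇ-cong (cov-not c) (allVecs n) ⟩
  countᵇ (λ b → cov (V.map not b) (V.map not c)) (allVecs n)
    ≡⟨ countᵇ-allVecs-not n (λ b → cov b (V.map not c)) ⟨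
  countᵇ (λ b → cov b (V.map not c)) (allVecs n)
    ≡⟨ countᵇ-cov (V.map not c) ⟩
  runs (V.map not c) ∎
  where open ≡-Reasoning

-- Paths with a given number of runs

pascal : ∀ n k → n C suc k + n C k ≡ suc n C suc k
pascal n k = trans (+-comm (n C suc k) _) (nCk+nC[k+1]≡[n+1]C[k+1] n k)

countᵇ-runs-true-zero : ∀ n → countᵇ (λ b → runs (true ∷ b) ≡ᵇ 0) (allVecs n) ≡ 0
countᵇ-runs-true-zero zero    = refl
countᵇ-runs-true-zero (suc n) = trans (countᵇ-allVecs-suc {n} (λ b → runs (true ∷ b) ≡ᵇ 0))
  (cong₂ _+_ (countᵇ-false (allVecs n)) (countᵇ-runs-true-zero n))

mutual
  countᵇ-runs : ∀ n k → countᵇ (λ b → runs b ≡ᵇ k) (allVecs n) ≡ suc n C (2 * k)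
  countᵇ-runs zero zero    = refl
  countᵇ-runs zero (suc k) = sym (k>n⇒nCk≡0 {1} {2 * suc k} (subst (1 <_) (sym (*-suc 2 k)) (s≤s (s≤s z≤n))))
  countᵇ-runs (suc n) zero = trans (countᵇ-allVecs-suc {n} (λ b → runs b ≡ᵇ 0))
    (cong₂ _+_ (countᵇ-runs n zero) (countᵇ-runs-true-zero n))
  countᵇ-runs (suc n) (suc k) = begin
    countᵇ (λ b → runs b ≡ᵇ suc k) (allVecs (suc n))
      ≡⟨ countᵇ-allVecs-suc {n} (λ b → runs b ≡ᵇ suc k) ⟩
    countᵇ (λ b → runs b ≡ᵇ suc k) (allVecs n) + countᵇ (λ b → runs (true ∷ b) ≡ᵇ suc k) (allVecs n)
      ≡⟨ cong₂ _+_ (countᵇ-runs n (suc k)) (countᵇ-runs-true n k) ⟩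
    suc n C (2 * suc k) + suc n C suc (2 * k)
      ≡⟨ cong (λ j → suc n C j + suc n C suc (2 * k)) (*-suc 2 k) ⟩
    suc n C suc (suc (2 * k)) + suc n C suc (2 * k)
      ≡⟨ pascal (suc n) (suc (2 * k)) ⟩
    suc (suc n) C suc (suc (2 * k))
      ≡⟨ cong (suc (suc n) C_) (*-suc 2 k) ⟨
    suc (suc n) C (2 * suc k) ∎
    where open ≡-Reasoning

  -- The odd companion of `countᵇ-runs`: with a 1 in front and a 0 behind, `suc k` runs mean 2k + 1
  -- changes of letter. Removing one letter passes between the two families exactly as in Pascal's
  -- triangle.
  countᵇ-runs-true : ∀ n k → countᵇ (λ b → runs (true ∷ b) ≡ᵇ suc k) (allVecs n) ≡ suc n C suc (2 * k)
  countᵇ-runs-true zero zero    = refl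
  countᵇ-runs-true zero (suc k) = sym (k>n⇒nCk≡0 {1} {suc (2 * suc k)} (s≤s (s≤s z≤n)))
  countᵇ-runs-true (suc n) k = begin
    countᵇ (λ b → runs (true ∷ b) ≡ᵇ suc k) (allVecs (suc n))
      ≡⟨ countᵇ-allVecs-suc {n} (λ b → runs (true ∷ b) ≡ᵇ suc k) ⟩
    countᵇ (λ b → runs b ≡ᵇ k) (allVecs n) + countᵇ (λ b → runs (true ∷ b) ≡ᵇ suc k) (allVecs n)
      ≡⟨ cong₂ _+_ (countᵇ-runs n k) (countᵇ-runs-true n k) ⟩
    suc n C (2 * k) + suc n C suc (2 * k)
      ≡⟨ nCk+nC[k+1]≡[n+1]C[k+1] (suc n) (2 * k) ⟩
    suc (suc n) C suc (2 * k) ∎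
    where open ≡-Reasoning

countᵇ-runs-not : ∀ n k → countᵇ (λ b → runs (V.map not b) ≡ᵇ k) (allVecs n) ≡ suc n C (2 * k)
countᵇ-runs-not n k = trans (sym (countᵇ-allVecs-not n (λ b → runs b ≡ᵇ k))) (countᵇ-runs n k)

-- Paths from sets of cells

-- A set Q of cells (m , i) with i < m ≤ n is the region under a height function as soon as it is
-- closed under (m , i) ↦ (m + 1 , i) and (m + 1 , i + 1) ↦ (m , i).
triangle⇒height : ∀ n (Q : ℕ → ℕ → Bool) →
  (∀ {m i} → m ≤ n → T (Q m i) → i < m) →
  (∀ {m i} → m < n → T (Q m i) → T (Q (suc m) i)) →
  (∀ {m i} → m < n → T (Q (suc m) (suc i)) → T (Q m i)) →
  ∃ λ (b : Vec Bool n) → ∀ {m i} → m ≤ n → T (Q m i) ⇔ i < height b m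
triangle⇒height zero Q below up down = [] , λ { z≤n → mk⇔ (λ q → ⊥-elim (n≮0 (below z≤n q))) λ () }
-- The cell (1 , 0) decides the first letter. If it lies in `Q`, then `up` fills the column i = 0
-- and the rest is a triangle shifted by (1 , 1). If not, `down` empties the main diagonal i = m -
-- 1, and without it a triangle of size `n` remains.
triangle⇒height (suc n) Q below up down with Q 1 0 in q₁₀
... | true = (true ∷ proj₁ rec) , λ
  { {zero} _ → mk⇔ (λ q → ⊥-elim (n≮0 (below z≤n q))) λ ()
  ; {suc m} {zero} (s≤s m≤n) → mk⇔ (λ _ → s≤s z≤n) (λ _ → bottom m m≤n)
  ; {suc m} {suc i} (s≤s m≤n) → mk⇔ (λ q → s≤s (Equivalence.to (proj₂ rec m≤n) q))
                                     (λ { (s≤s i<) → Equivalence.from (proj₂ rec m≤n) i< }) }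
  where
  rec = triangle⇒height n (λ m i → Q (suc m) (suc i)) (λ m≤n → ≤-pred ∘ below (s≤s m≤n))
          (λ m<n → up (s≤s m<n)) (λ m<n → down (s≤s m<n))
  bottom : ∀ m → m ≤ n → T (Q (suc m) 0)
  bottom zero    _   = subst T (sym q₁₀) _
  bottom (suc m) m<n = up (s≤s m<n) (bottom m (<⇒≤ m<n))
... | false = (false ∷ proj₁ rec) , λ
  { {zero} _ → mk⇔ (λ q → ⊥-elim (n≮0 (below z≤n q))) λ ()
  ; {suc m} (s≤s m≤n) → proj₂ rec m≤n }
  where
  noDiagonal : ∀ m → m ≤ n → ¬ T (Q (suc m) m)
  noDiagonal zero    _   q = subst T q₁₀ q
  noDiagonal (suc m) m<n q = noDiagonal m (<⇒≤ m<n) (down (s≤s m<n) q)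
  strict : ∀ {m i} → m ≤ n → T (Q (suc m) i) → i < m
  strict {m} m≤n q = ≤∧≢⇒< (≤-pred (below (s≤s m≤n) q)) λ { refl → noDiagonal m m≤n q }
  rec = triangle⇒height n (λ m i → Q (suc m) i) strict (λ m<n → up (s≤s m<n)) (λ m<n → down (s≤s m<n))

-- Arithmetic of weight vectors

-- ε with 0-based ℕ-indices; the zero vector when a ≥ n.
e : ∀ {n} → ℕ → Wt n
e a = V.tabulate (λ k → if toℕ k ≡ᵇ a then + 1 else + 0)

≟F⇒≡ᵇ : ∀ {n} (k i : Fin n) → ⌊ k ≟F i ⌋ ≡ (toℕ k ≡ᵇ toℕ i)
≟F⇒≡ᵇ k i with k ≟F i
... | yes refl = T-ext (λ _ → ≡⇒≡ᵇ (toℕ k) (toℕ k) refl) _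
... | no k≢i   = T-ext (λ ()) (λ t → k≢i (toℕ-injective (≡ᵇ⇒≡ (toℕ k) (toℕ i) t)))

ε≡e : ∀ {n} (i : Fin n) → ε i ≡ e (toℕ i)
ε≡e i = V.tabulate-cong (λ k → cong (if_then + 1 else + 0) (≟F⇒≡ᵇ k i))

tabulate-+ʷ : ∀ {n} (f g : Fin n → ℤ) → V.tabulate f +ʷ V.tabulate g ≡ V.tabulate (λ k → f k ℤ.+ g k)
tabulate-+ʷ {zero}  f g = refl
tabulate-+ʷ {suc n} f g = cong ((f zero ℤ.+ g zero) ∷_) (tabulate-+ʷ (f ∘ suc) (g ∘ suc))

scaledUnit-2 : ∀ {n} (i : Fin n) → scaledUnit (+ 2) i ≡ e (toℕ i) +ʷ e (toℕ i)
scaledUnit-2 i = trans (V.tabulate-cong eq) (sym (tabulate-+ʷ _ _))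
  where
  eq : ∀ k → (if ⌊ k ≟F i ⌋ then + 2 else + 0) ≡
             (if toℕ k ≡ᵇ toℕ i then + 1 else + 0) ℤ.+ (if toℕ k ≡ᵇ toℕ i then + 1 else + 0)
  eq k rewrite ≟F⇒≡ᵇ k i with toℕ k ≡ᵇ toℕ i
  ... | true  = refl
  ... | false = refl

open AbelianGroup ℤ.+-0-abelianGroup using (group)
open import Algebra.Properties.Group group using () renaming (∙-cancelʳ to ℤ-cancelʳ)

private
  variable
    n : ℕ

+ʷ-comm : ∀ (u v : Wt n) → u +ʷ v ≡ v +ʷ u
+ʷ-comm = V.zipWith-comm ℤ.+-comm

+ʷ-assoc : ∀ (u v w : Wt n) → (u +ʷ v) +ʷ w ≡ u +ʷ (v +ʷ w)
+ʷ-assoc = V.zipWith-assoc ℤ.+-assoc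

+ʷ-cancelʳ : ∀ (u v w : Wt n) → u +ʷ w ≡ v +ʷ w → u ≡ v
+ʷ-cancelʳ []      []      []      _  = refl
+ʷ-cancelʳ (x ∷ u) (y ∷ v) (z ∷ w) eq =
  cong₂ _∷_ (ℤ-cancelʳ z x y (V.∷-injectiveˡ eq)) (+ʷ-cancelʳ u v w (V.∷-injectiveʳ eq))

-ʷ+ʷ : ∀ (u v : Wt n) → (u -ʷ v) +ʷ v ≡ u
-ʷ+ʷ []      []      = refl
-ʷ+ʷ (x ∷ u) (y ∷ v) = cong₂ _∷_ (eq x y) (-ʷ+ʷ u v)
  where
  eq : ∀ x y → (x ℤ.- y) ℤ.+ y ≡ x
  eq = solve-∀

+ʷ⇒-ʷ : ∀ {u v w : Wt n} → u ≡ w +ʷ v → u -ʷ v ≡ w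
+ʷ⇒-ʷ {u = u} {v} {w} eq = +ʷ-cancelʳ _ _ v (trans (-ʷ+ʷ u v) eq)

-ʷ⇒+ʷ : ∀ {u v w : Wt n} → u -ʷ v ≡ w → u ≡ w +ʷ v
-ʷ⇒+ʷ {u = u} {v} eq = trans (sym (-ʷ+ʷ u v)) (cong (_+ʷ v) eq)

+ʷ-swapʳ : ∀ (u v w : Wt n) → (u +ʷ v) +ʷ w ≡ (u +ʷ w) +ʷ v
+ʷ-swapʳ u v w = trans (+ʷ-assoc u v w) (trans (cong (u +ʷ_) (+ʷ-comm v w)) (sym (+ʷ-assoc u w v)))

-- Moves negative terms across, so that only sums of vectors `e a` remain. Their coordinates are
-- nonnegative, and this is what the splitting lemmas rely on.
-ʷ≡-ʷ⇒+ʷ≡+ʷ : ∀ {u v u′ v′ : Wt n} → u -ʷ v ≡ u′ -ʷ v′ → u +ʷ v′ ≡ v +ʷ u′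
-ʷ≡-ʷ⇒+ʷ≡+ʷ {u = u} {v} {u′} {v′} eq = begin
  u +ʷ v′                 ≡⟨ cong (_+ʷ v′) (-ʷ⇒+ʷ eq) ⟩
  ((u′ -ʷ v′) +ʷ v) +ʷ v′ ≡⟨ +ʷ-swapʳ (u′ -ʷ v′) v v′ ⟩
  ((u′ -ʷ v′) +ʷ v′) +ʷ v ≡⟨ cong (_+ʷ v) (-ʷ+ʷ u′ v′) ⟩
  u′ +ʷ v                 ≡⟨ +ʷ-comm u′ v ⟩
  v +ʷ u′                 ∎
  where open ≡-Reasoning

-- An additive grading: it vanishes on the simple roots εᵢ - εᵢ₊₁ and is 2 on 2εₙ, so on roots it is
-- twice the coefficient of the long simple root.
total : Wt n → ℤ
total []      = + 0
total (x ∷ v) = x ℤ.+ total v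

total-+ʷ : ∀ (u v : Wt n) → total (u +ʷ v) ≡ total u ℤ.+ total v
total-+ʷ []      []      = refl
total-+ʷ (x ∷ u) (y ∷ v) = trans (cong (λ t → x ℤ.+ y ℤ.+ t) (total-+ʷ u v)) (eq x y (total u) (total v))
  where
  eq : ∀ x y s t → x ℤ.+ y ℤ.+ (s ℤ.+ t) ≡ x ℤ.+ s ℤ.+ (y ℤ.+ t)
  eq = solve-∀

coord : Wt n → ℕ → ℤ
coord []      _       = + 0
coord (x ∷ v) zero    = x
coord (x ∷ v) (suc a) = coord v a

coord-+ʷ : ∀ (u v : Wt n) a → coord (u +ʷ v) a ≡ coord u a ℤ.+ coord v a
coord-+ʷ []      []      a       = refl
coord-+ʷ (x ∷ u) (y ∷ v) zero    = refl
coord-+ʷ (x ∷ u) (y ∷ v) (suc a) = coord-+ʷ u v a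

coord-zeros : ∀ n a → coord {n} (V.tabulate (λ _ → + 0)) a ≡ + 0
coord-zeros zero    a       = refl
coord-zeros (suc n) zero    = refl
coord-zeros (suc n) (suc a) = coord-zeros n a

total-zeros : ∀ n → total {n} (V.tabulate (λ _ → + 0)) ≡ + 0
total-zeros zero    = refl
total-zeros (suc n) = trans (ℤ.+-identityˡ _) (total-zeros n)

total-e : ∀ {n a} → a < n → total {n} (e a) ≡ + 1
total-e {suc n} {zero}  _         = cong (λ t → + 1 ℤ.+ t) (total-zeros n)
total-e {suc n} {suc a} (s≤s a<n) = trans (ℤ.+-identityˡ _) (total-e a<n)

coord-e : ∀ {n a} → a < n → coord {n} (e a) a ≡ + 1
coord-e {suc n} {zero}  _         = refl
coord-e {suc n} {suc a} (s≤s a<n) = coord-e a<n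

coord-e-≢ : ∀ {n} a b → a ≢ b → coord {n} (e a) b ≡ + 0
coord-e-≢ {zero}  a       b       a≢b = refl
coord-e-≢ {suc n} zero    zero    a≢b = ⊥-elim (a≢b refl)
coord-e-≢ {suc n} zero    (suc b) a≢b = coord-zeros n b
coord-e-≢ {suc n} (suc a) zero    a≢b = refl
coord-e-≢ {suc n} (suc a) (suc b) a≢b = coord-e-≢ {n} a b (a≢b ∘ cong suc)

coord-e-nonneg : ∀ {n} a b → ∃ λ m → coord {n} (e a) b ≡ + m
coord-e-nonneg {zero}  a       b       = 0 , refl
coord-e-nonneg {suc n} zero    zero    = 1 , refl
coord-e-nonneg {suc n} zero    (suc b) = 0 , coord-zeros n b
coord-e-nonneg {suc n} (suc a) zero    = 0 , refl
coord-e-nonneg {suc n} (suc a) (suc b) = coord-e-nonneg {n} a b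

-- Coordinate `t` of the left side is at least 1, as nothing there can cancel the contribution of
-- `e t`. On the right it would be 0 if `t` differed from all three indices.
e+e+e-split : ∀ {n} i j a k l t → t < n →
  _≡_ {A = Wt n} ((e k +ʷ e l) +ʷ e t) ((e i +ʷ e j) +ʷ e a) → t ≡ i ⊎ t ≡ j ⊎ t ≡ a
e+e+e-split {n} i j a k l t t<n eq with t ≟ i | t ≟ j | t ≟ a
... | yes t≡i | _ | _ = inj₁ t≡i
... | no _ | yes t≡j | _ = inj₂ (inj₁ t≡j)
... | no _ | no _ | yes t≡a = inj₂ (inj₂ t≡a)
... | no t≢i | no t≢j | no t≢a
  with p , pe ← coord-e-nonneg {n} k t | q , qe ← coord-e-nonneg {n} l t
  = ⊥-elim (m+1+n≢0 (p + q) (ℤ.+-injective absurd))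
  where
  expand : ∀ x y z → coord {n} ((e x +ʷ e y) +ʷ e z) t ≡ (coord {n} (e x) t ℤ.+ coord {n} (e y) t) ℤ.+ coord {n} (e z) t
  expand x y z = trans (coord-+ʷ {n} (e x +ʷ e y) (e z) t) (cong (ℤ._+ coord {n} (e z) t) (coord-+ʷ {n} (e x) (e y) t))
  absurd : + (p + q + 1) ≡ + 0
  absurd = begin
    (+ p ℤ.+ + q) ℤ.+ + 1
      ≡⟨ cong₂ ℤ._+_ (cong₂ ℤ._+_ pe qe) (coord-e {n} t<n) ⟨
    (coord {n} (e k) t ℤ.+ coord {n} (e l) t) ℤ.+ coord {n} (e t) t
      ≡⟨ expand k l t ⟨
    coord {n} ((e k +ʷ e l) +ʷ e t) t
      ≡⟨ cong (λ v → coord v t) eq ⟩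
    coord {n} ((e i +ʷ e j) +ʷ e a) t
      ≡⟨ expand i j a ⟩
    (coord {n} (e i) t ℤ.+ coord {n} (e j) t) ℤ.+ coord {n} (e a) t
      ≡⟨ cong₂ ℤ._+_ (cong₂ ℤ._+_ (coord-e-≢ {n} i t (t≢i ∘ sym)) (coord-e-≢ {n} j t (t≢j ∘ sym))) (coord-e-≢ {n} a t (t≢a ∘ sym)) ⟩
    + 0 ∎
    where open ≡-Reasoning

-- Padding with e n = 0 reduces to sums of three.
e+e-split : ∀ {n} i j k l → k < n → _≡_ {A = Wt n} (e k +ʷ e l) (e i +ʷ e j) → k ≡ i ⊎ k ≡ j
e+e-split {n} i j k l k<n eq with e+e+e-split i j n n l k k<n (begin
    (e n +ʷ e l) +ʷ e k ≡⟨ +ʷ-assoc (e n) (e l) (e k) ⟩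
    e n +ʷ (e l +ʷ e k) ≡⟨ +ʷ-comm (e n) (e l +ʷ e k) ⟩
    (e l +ʷ e k) +ʷ e n ≡⟨ cong (_+ʷ e n) (+ʷ-comm (e l) (e k)) ⟩
    (e k +ʷ e l) +ʷ e n ≡⟨ cong (_+ʷ e n) eq ⟩
    (e i +ʷ e j) +ʷ e n ∎)
  where open ≡-Reasoning
... | inj₁ k≡i = inj₁ k≡i
... | inj₂ (inj₁ k≡j) = inj₂ k≡j
... | inj₂ (inj₂ k≡n) = ⊥-elim (<⇒≢ k<n k≡n)

e-injective : ∀ {n a b} → a < n → e {n} a ≡ e b → a ≡ b
e-injective {n} {a} {b} a<n eq with e+e-split b b a a a<n (cong₂ _+ʷ_ eq eq)
... | inj₁ a≡b = a≡b
... | inj₂ a≡b = a≡b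

+ʷ-cancelˡ : ∀ {n} (u v w : Wt n) → w +ʷ u ≡ w +ʷ v → u ≡ v
+ʷ-cancelˡ u v w eq = +ʷ-cancelʳ u v w (trans (+ʷ-comm u w) (trans eq (+ʷ-comm w v)))

e+e-injective : ∀ {n i j k l} → k ≤ l → l < n → i ≤ j → j < n →
  _≡_ {A = Wt n} (e k +ʷ e l) (e i +ʷ e j) → k ≡ i × l ≡ j
e+e-injective {i = i} {j} {k} {l} k≤l l<n i≤j j<n eq with e+e-split i j k l (≤-<-trans k≤l l<n) eq
... | inj₁ refl = refl , e-injective l<n (+ʷ-cancelˡ _ _ (e k) eq)
-- The crossed matching `k ≡ j`, `l ≡ i` respects both orderings only if all four indices coincide.
... | inj₂ refl with e-injective l<n (+ʷ-cancelˡ _ _ (e k) (trans eq (+ʷ-comm (e i) (e k))))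
... | refl = ≤-antisym k≤l i≤j , ≤-antisym i≤j k≤l

-- Labels of positive roots

-- `dif a b` names εₐ - ε_b and `add a b` names εₐ + ε_b, with indices counted from 0. The long root
-- 2εₐ is `add a a`, so that the triangle of the roots εᵢ + εⱼ is a single family.
data Label : Set where
  dif add : ℕ → ℕ → Label

wt : ∀ {n} → Label → Wt n
wt (dif a b) = e a -ʷ e b
wt (add a b) = e a +ʷ e b

ends : Label → ℕ × ℕ
ends (dif a b) = a , b
ends (add a b) = a , b

Valid : ℕ → Label → Set
Valid n (dif a b) = a < b × b < n
Valid n (add a b) = a ≤ b × b < n

degree : Label → ℤ
degree (dif _ _) = + 0
degree (add _ _) = + 2

total-wt : ∀ {n} l → Valid n l → total (wt {n} l) ≡ degree l
total-wt {n} (add a b) (a≤b , b<n) = trans (total-+ʷ {n} (e a) (e b))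
  (cong₂ ℤ._+_ (total-e (≤-<-trans a≤b b<n)) (total-e b<n))
total-wt {n} (dif a b) (a<b , b<n) = ℤ-cancelʳ (+ 1) _ _ (begin
  total {n} (wt (dif a b)) ℤ.+ + 1             ≡⟨ cong (λ t → total {n} (wt (dif a b)) ℤ.+ t) (total-e b<n) ⟨
  total {n} (wt (dif a b)) ℤ.+ total {n} (e b) ≡⟨ total-+ʷ {n} (wt (dif a b)) (e b) ⟨
  total {n} (wt (dif a b) +ʷ e b)              ≡⟨ cong total (-ʷ+ʷ {n} (e a) (e b)) ⟩
  total {n} (e a)                              ≡⟨ total-e (<-trans a<b b<n) ⟩
  + 1 ∎)
  where open ≡-Reasoning

-- `total` separates the two families. Between two differences, the equation becomes
-- `e a +ʷ e b′ ≡ e b +ʷ e a′`, and `a < b` leaves only `a′` to match `a`.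
wt-injective : ∀ {n} l l′ → Valid n l → Valid n l′ → wt {n} l ≡ wt l′ → l ≡ l′
wt-injective (add a b) (add a′ b′) (a≤b , b<n) (a′≤b′ , b′<n) eq
  with refl , refl ← e+e-injective a≤b b<n a′≤b′ b′<n eq = refl
wt-injective (add a b) (dif a′ b′) v v′ eq with () ← trans (sym (total-wt (add a b) v)) (trans (cong total eq) (total-wt (dif a′ b′) v′))
wt-injective (dif a b) (add a′ b′) v v′ eq with () ← trans (sym (total-wt (dif a b) v)) (trans (cong total eq) (total-wt (add a′ b′) v′))
wt-injective {n} (dif a b) (dif a′ b′) (a<b , b<n) (a′<b′ , b′<n) eq
  with e+e-split b a′ a b′ (<-trans a<b b<n) (-ʷ≡-ʷ⇒+ʷ≡+ʷ eq)
... | inj₁ a≡b = ⊥-elim (<⇒≢ a<b a≡b)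
... | inj₂ refl = cong (dif a) (sym (e-injective b′<n
      (+ʷ-cancelˡ _ _ (e a) (trans (-ʷ≡-ʷ⇒+ʷ≡+ʷ {u = e a} {e b} {e a} {e b′} eq) (+ʷ-comm (e b) (e a))))))

IsRoot : ∀ {n} → Wt n → Set
IsRoot {n} v = ∃ λ l → Valid n l × v ≡ wt l

data IsSimple {n} (v : Wt n) : Set where
  step : ∀ a → suc a < n → v ≡ wt (dif a (suc a)) → IsSimple v
  last : ∀ a → suc a ≡ n → v ≡ wt (add a a) → IsSimple v

-- The lists of positive and simple roots in terms of labels

∈⇒any : ∀ {n} {v : Wt n} {xs} → v ∈ xs → T (any (v ==ʷ_) xs)
∈⇒any {v = v} v∈xs = any⁺ (v ==ʷ_) (Any.map fromWitness v∈xs)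

any⇒∈ : ∀ {n} {v : Wt n} xs → T (any (v ==ʷ_) xs) → v ∈ xs
any⇒∈ {v = v} xs t = Any.map toWitness (any⁻ (v ==ʷ_) xs t)

∈-if : ∀ {A : Set} {c} {v : A} {xs} → v ∈ (if c then xs else []) → T c × v ∈ xs
∈-if {c = true} v∈ = _ , v∈

∈-if⁺ : ∀ {A : Set} {c} {v : A} {xs} → T c → v ∈ xs → v ∈ (if c then xs else [])
∈-if⁺ {c = true} _ v∈ = v∈

∈-rows⁻ : ∀ {A : Set} {n v} (f : Fin n → List A) → v ∈ concatMap f (allFin n) → ∃ λ i → v ∈ f i
∈-rows⁻ {n = n} f v∈ with i , _ , v∈fi ← find (∈-concatMap⁻ f {xs = allFin n} v∈) = i , v∈fi

∈-rows⁺ : ∀ {A : Set} {n v} (f : Fin n → List A) i → v ∈ f i → v ∈ concatMap f (allFin n)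
∈-rows⁺ f i v∈fi = ∈-concatMap⁺ f (lose (∈-allFin i) v∈fi)

ε-ε≡wt : ∀ {n} (i j : Fin n) → ε i -ʷ ε j ≡ wt (dif (toℕ i) (toℕ j))
ε-ε≡wt i j = cong₂ _-ʷ_ (ε≡e i) (ε≡e j)

ε+ε≡wt : ∀ {n} (i j : Fin n) → ε i +ʷ ε j ≡ wt (add (toℕ i) (toℕ j))
ε+ε≡wt i j = cong₂ _+ʷ_ (ε≡e i) (ε≡e j)

cell : ∀ {n} → Fin n → Fin n → List (Wt n)
cell i j = if toℕ i <ᵇ toℕ j then (ε i -ʷ ε j) ∷ (ε i +ʷ ε j) ∷ [] else []

row : ∀ {n} → Fin n → List (Wt n)
row {n} i = concatMap (cell i) (allFin n)

∈-cell : ∀ {n v} {i j : Fin n} → v ∈ cell i j →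
  toℕ i < toℕ j × ∃ λ l → Valid n l × v ≡ wt l × ends l ≡ (toℕ i , toℕ j)
∈-cell {i = i} {j} v∈ with ∈-if {c = toℕ i <ᵇ toℕ j} v∈
... | lt , here refl         = i<j , dif (toℕ i) (toℕ j) , (i<j , toℕ<n j) , ε-ε≡wt i j , refl
  where i<j = <ᵇ⇒< (toℕ i) (toℕ j) lt
... | lt , there (here refl) = i<j , add (toℕ i) (toℕ j) , (<⇒≤ i<j , toℕ<n j) , ε+ε≡wt i j , refl
  where i<j = <ᵇ⇒< (toℕ i) (toℕ j) lt

∈-row : ∀ {n v} {i : Fin n} → v ∈ row i →
  ∃ λ j → toℕ i < toℕ j × ∃ λ l → Valid n l × v ≡ wt l × ends l ≡ (toℕ i , toℕ j)
∈-row {i = i} v∈ with j , v∈′ ← ∈-rows⁻ (cell i) v∈ = j , ∈-cell v∈′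

posRoot⇒IsRoot : ∀ {n} {v : Wt n} → v ∈ posRoots n → IsRoot v
posRoot⇒IsRoot {n} v∈ with ∈-++⁻ (concatMap row (allFin n)) v∈
... | inj₁ v∈rows with i , v∈row ← ∈-rows⁻ row v∈rows with ∈-row v∈row
...   | j , _ , l , v , eq , _ = l , v , eq
posRoot⇒IsRoot {n} v∈ | inj₂ v∈long with i , _ , eq ← ∈-map⁻ (scaledUnit (+ 2)) v∈long =
  add (toℕ i) (toℕ i) , (≤-refl , toℕ<n i) , trans eq (scaledUnit-2 i)

wt-fromℕ< : ∀ {n a b} (a<n : a < n) (b<n : b < n) (f : ℕ → ℕ → Label) →
  wt {n} (f (toℕ (fromℕ< a<n)) (toℕ (fromℕ< b<n))) ≡ wt (f a b)
wt-fromℕ< a<n b<n f = cong₂ (λ x y → wt (f x y)) (toℕ-fromℕ< a<n) (toℕ-fromℕ< b<n)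

cell⇒posRoot : ∀ {n a b} (a<n : a < n) (b<n : b < n) → ∀ {v} → a < b →
  v ∈ (ε (fromℕ< a<n) -ʷ ε (fromℕ< b<n)) ∷ (ε (fromℕ< a<n) +ʷ ε (fromℕ< b<n)) ∷ [] → v ∈ posRoots n
cell⇒posRoot {n} a<n b<n a<b v∈ =
  ∈-++⁺ˡ (∈-rows⁺ row i (∈-rows⁺ (cell i) j (∈-if⁺
    (<⇒<ᵇ (subst₂ _<_ (sym (toℕ-fromℕ< a<n)) (sym (toℕ-fromℕ< b<n)) a<b)) v∈)))
  where
  i = fromℕ< a<n
  j = fromℕ< b<n

valid⇒posRoot : ∀ {n} l → Valid n l → wt l ∈ posRoots n
valid⇒posRoot {n} (dif a b) (a<b , b<n) = cell⇒posRoot a<n b<n a<b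
  (here (sym (trans (ε-ε≡wt (fromℕ< a<n) (fromℕ< b<n)) (wt-fromℕ< a<n b<n dif))))
  where a<n = <-trans a<b b<n
valid⇒posRoot {n} (add a b) (a≤b , b<n) with m≤n⇒m<n∨m≡n a≤b
... | inj₁ a<b = cell⇒posRoot a<n b<n a<b
  (there (here (sym (trans (ε+ε≡wt (fromℕ< a<n) (fromℕ< b<n)) (wt-fromℕ< a<n b<n add)))))
  where a<n = <-trans a<b b<n
... | inj₂ refl = ∈-++⁺ʳ (concatMap row (allFin n)) (subst (_∈ L.map (scaledUnit (+ 2)) (allFin n))
  (trans (scaledUnit-2 (fromℕ< b<n)) (wt-fromℕ< b<n b<n add)) (∈-map⁺ (scaledUnit (+ 2)) (∈-allFin (fromℕ< b<n))))

simpleCell : ∀ {n} → Fin n → Fin n → List (Wt n)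
simpleCell i j = if suc (toℕ i) ≡ᵇ toℕ j then (ε i -ʷ ε j) ∷ [] else []

simpleRow : ∀ {n} → Fin n → List (Wt n)
simpleRow {n} i = concatMap (simpleCell i) (allFin n)

longCell : ∀ {n} → Fin n → List (Wt n)
longCell {n} i = if suc (toℕ i) ≡ᵇ n then scaledUnit (+ 2) i ∷ [] else []

simpleRoot⇒IsSimple : ∀ {n} {v : Wt n} → v ∈ simpleRoots n → IsSimple v
simpleRoot⇒IsSimple {n} v∈ with ∈-++⁻ (concatMap simpleRow (allFin n)) v∈
simpleRoot⇒IsSimple {n} v∈ | inj₁ v∈rows
  with i , v∈row ← ∈-rows⁻ simpleRow v∈rows
  with j , v∈cell ← ∈-rows⁻ (simpleCell i) v∈row
  with eq , here refl ← ∈-if {c = suc (toℕ i) ≡ᵇ toℕ j} v∈cell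
  with 1+i≡j ← ≡ᵇ⇒≡ (suc (toℕ i)) (toℕ j) eq =
  step (toℕ i) (subst (_< n) (sym 1+i≡j) (toℕ<n j)) (trans (ε-ε≡wt i j) (cong (wt ∘ dif (toℕ i)) (sym 1+i≡j)))
simpleRoot⇒IsSimple {n} v∈ | inj₂ v∈long
  with i , v∈cell ← ∈-rows⁻ longCell v∈long
  with eq , here refl ← ∈-if {c = suc (toℕ i) ≡ᵇ n} v∈cell =
  last (toℕ i) (≡ᵇ⇒≡ (suc (toℕ i)) n eq) (scaledUnit-2 i)

IsSimple⇒simpleRoot : ∀ {n} {v : Wt n} → IsSimple v → v ∈ simpleRoots n
IsSimple⇒simpleRoot {n} (step a a+1<n refl) =
  ∈-++⁺ˡ (∈-rows⁺ simpleRow i (∈-rows⁺ (simpleCell i) j (∈-if⁺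
    (≡⇒≡ᵇ (suc (toℕ i)) (toℕ j) (trans (cong suc (toℕ-fromℕ< a<n)) (sym (toℕ-fromℕ< a+1<n))))
    (here (sym (trans (ε-ε≡wt i j) (wt-fromℕ< a<n a+1<n dif)))))))
  where
  a<n = <-trans (n<1+n a) a+1<n
  i = fromℕ< a<n
  j = fromℕ< a+1<n
IsSimple⇒simpleRoot {n} (last a refl refl) =
  ∈-++⁺ʳ (concatMap simpleRow (allFin n)) (∈-rows⁺ longCell i (∈-if⁺
    (≡⇒≡ᵇ (suc (toℕ i)) n (cong suc (toℕ-fromℕ< (n<1+n a))))
    (here (sym (trans (scaledUnit-2 i) (wt-fromℕ< (n<1+n a) (n<1+n a) add))))))
  where
  i = fromℕ< (n<1+n a)

-- Each positive root is listed once

concatMap-unique : ∀ {A B : Set} {f : A → List B} {xs} → Unique xs → (∀ x → Unique (f x)) →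
  (∀ {x y v} → v ∈ f x → v ∈ f y → x ≡ y) → Unique (concatMap f xs)
concatMap-unique xs! f! inj = Unique.concat⁺ (All.map⁺ (All.universal f! _))
  (AllPairs.map⁺ (AllPairs.map (λ x≢y {_} (v∈fx , v∈fy) → x≢y (inj v∈fx v∈fy)) xs!))

-- By `wt-injective` a root determines its pair of indices. Hence different rows, different cells of
-- a row, and the long roots share no vector.
ends-unique : ∀ {n v a b a′ b′} l l′ → Valid n l → v ≡ wt {n} l → ends l ≡ (a , b) →
  Valid n l′ → v ≡ wt l′ → ends l′ ≡ (a′ , b′) → a ≡ a′ × b ≡ b′
ends-unique l l′ v eq refl v′ eq′ refl with refl ← wt-injective l l′ v v′ (trans (sym eq) eq′) = refl , refl

cell-disjoint : ∀ {n v} {i j j′ : Fin n} → v ∈ cell i j → v ∈ cell i j′ → j ≡ j′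
cell-disjoint v∈ v∈′ with ∈-cell v∈ | ∈-cell v∈′
... | _ , l , ok , eq , ends≡ | _ , l′ , ok′ , eq′ , ends≡′ =
  toℕ-injective (proj₂ (ends-unique l l′ ok eq ends≡ ok′ eq′ ends≡′))

row-disjoint : ∀ {n v} {i i′ : Fin n} → v ∈ row i → v ∈ row i′ → i ≡ i′
row-disjoint v∈ v∈′ with ∈-row v∈ | ∈-row v∈′
... | _ , _ , l , ok , eq , ends≡ | _ , _ , l′ , ok′ , eq′ , ends≡′ =
  toℕ-injective (proj₁ (ends-unique l l′ ok eq ends≡ ok′ eq′ ends≡′))

cell-unique : ∀ {n} (i j : Fin n) → Unique (cell i j)
cell-unique {n} i j with toℕ i <ᵇ toℕ j in lt
... | false = []
... | true  = ((λ eq → dif≢add (wt-injective (dif (toℕ i) (toℕ j)) (add (toℕ i) (toℕ j)) (i<j , toℕ<n j) (<⇒≤ i<j , toℕ<n j)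
                 (trans (sym (ε-ε≡wt i j)) (trans eq (ε+ε≡wt i j))))) All.∷ All.[]) ∷ All.[] ∷ []
  where
  i<j = <ᵇ⇒< (toℕ i) (toℕ j) (subst T (sym lt) _)
  dif≢add : ∀ {a b a′ b′} → dif a b ≢ add a′ b′
  dif≢add ()

-- Subsets of Δ⁺ are indexed by positions in `posRoots`. Without repetitions a position is
-- determined by its root, so membership becomes a property of the root.
posRoots-unique : ∀ n → Unique (posRoots n)
posRoots-unique n = Unique.++⁺
  (concatMap-unique {xs = allFin n} (Unique.allFin⁺ n) (λ i → concatMap-unique {xs = allFin n} (Unique.allFin⁺ n) (cell-unique i) cell-disjoint) row-disjoint)
  (Unique.map⁺ (λ {i} {i′} eq → toℕ-injective (proj₁ (ends-unique (add (toℕ i) (toℕ i)) (add (toℕ i′) (toℕ i′)) (≤-refl , toℕ<n i) (scaledUnit-2 i) refl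
    (≤-refl , toℕ<n i′) (trans eq (scaledUnit-2 i′)) refl))) (Unique.allFin⁺ n))
  disjoint
  where
  disjoint : ∀ {v} → ¬ (v ∈ concatMap row (allFin n) × v ∈ L.map (scaledUnit (+ 2)) (allFin n))
  disjoint (v∈rows , v∈long)
    with i , v∈row ← ∈-rows⁻ row v∈rows
    with j , i<j , l , ok , eq , ends≡ ← ∈-row v∈row
    with k , _ , eq′ ← ∈-map⁻ (scaledUnit (+ 2)) v∈long
    with i≡k , j≡k ← ends-unique l (add (toℕ k) (toℕ k)) ok eq ends≡ (≤-refl , toℕ<n k) (trans eq′ (scaledUnit-2 k)) refl
    = <⇒≢ i<j (trans i≡k (sym j≡k))

lookup-injective : ∀ {A : Set} {xs : List A} → Unique xs → ∀ i j → L.lookup xs i ≡ L.lookup xs j → i ≡ j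
lookup-injective (x∉ ∷ xs!) zero    zero    eq = refl
lookup-injective (x∉ ∷ xs!) zero    (suc j) eq = ⊥-elim (All.lookup x∉ (∈-lookup j) eq)
lookup-injective (x∉ ∷ xs!) (suc i) zero    eq = ⊥-elim (All.lookup x∉ (∈-lookup i) (sym eq))
lookup-injective (x∉ ∷ xs!) (suc i) (suc j) eq = cong suc (lookup-injective xs! i j eq)

-- Abelian ideals in terms of labels

all⇒∀ : ∀ {m} (p : Fin m → Bool) → T (all p (allFin m)) → ∀ i → T (p i)
all⇒∀ {m} p t i = All.lookup (All.all⁺ p (allFin m) t) (∈-allFin i)

∀⇒all : ∀ {m} (p : Fin m → Bool) → (∀ i → T (p i)) → T (all p (allFin m))
∀⇒all {m} p h = All.all⁻ p (All.universal h (allFin m))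

⇒ᵇ-elim : ∀ {x y} → T (x ⇒ᵇ y) → T x → T y
⇒ᵇ-elim {true} t _ = t

⇒ᵇ-intro : ∀ {x y} → (T x → T y) → T (x ⇒ᵇ y)
⇒ᵇ-intro {true}  f = f _
⇒ᵇ-intro {false} f = _

∧-intro : ∀ {x y} → T x → T y → T (x ∧ y)
∧-intro tx ty = Equivalence.from Bool.T-∧ (tx , ty)

∧-elim : ∀ {x y} → T (x ∧ y) → T x × T y
∧-elim = Equivalence.to Bool.T-∧

not-intro : ∀ {x} → ¬ T x → T (not x)
not-intro {true}  f = f _
not-intro {false} f = _

not-elim : ∀ {x} → T (not x) → ¬ T x
not-elim {false} _ ()

root-injective : ∀ {n} k k′ → root n k ≡ root n k′ → k ≡ k′
root-injective {n} = lookup-injective (posRoots-unique n)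

label : ∀ n (k : Fin (N n)) → IsRoot (root n k)
label n k = posRoot⇒IsRoot (∈-lookup k)

index : ∀ n l → Valid n l → ∃ λ k → root n k ≡ wt l
index n l ok = Any.index l∈ , sym (lookup-index l∈)
  where l∈ = valid⇒posRoot l ok

In : ∀ n → SubΔ n → Label → Set
In n S l = ∃ λ k → root n k ≡ wt l × T (mem n k S)

In? : ∀ n S l → Dec (In n S l)
In? n S l = any? λ k → V.≡-dec ℤ._≟_ (root n k) (wt l) ×-dec T? (mem n k S)

record IsAbelianIdeal n (S : SubΔ n) : Set where
  field
    upper : ∀ l l′ → Valid n l → Valid n l′ → In n S l → IsSimple (wt {n} l′ -ʷ wt l) → In n S l′
    abelian : ∀ l l′ → Valid n l → Valid n l′ → In n S l → In n S l′ → ¬ IsRoot (wt {n} l +ʷ wt l′)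

∈Ab⇒ideal : ∀ n {S} → S ∈ Ab n → IsAbelianIdeal n S
∈Ab⇒ideal n {S} S∈ with t ← proj₂ (∈-filter⁻ (λ S → T? (isUpperIdeal n S ∧ isAbelian n S)) {xs = allVecs (N n)} S∈)
  with up , ab ← ∧-elim {isUpperIdeal n S} t = record
  { upper = λ l l′ ok ok′ (k , eq , k∈) simple → let k′ , eq′ = index n l′ ok′ in
      k′ , eq′ , ⇒ᵇ-elim (all⇒∀ _ (all⇒∀ _ up k) k′) (∧-intro k∈
        (∈⇒any (IsSimple⇒simpleRoot (subst IsSimple (sym (cong₂ _-ʷ_ eq′ eq)) simple))))
  ; abelian = λ l l′ ok ok′ (k , eq , k∈) (k′ , eq′ , k′∈) (l″ , ok″ , eq″) →
      not-elim (⇒ᵇ-elim (all⇒∀ _ (all⇒∀ _ ab k) k′) (∧-intro k∈ k′∈))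
        (∈⇒any (subst (_∈ posRoots n) (trans (sym eq″) (sym (cong₂ _+ʷ_ eq eq′))) (valid⇒posRoot l″ ok″)))
  }

∈-allVecs : ∀ {m} (v : Vec Bool m) → v ∈ allVecs m
∈-allVecs []          = here refl
∈-allVecs (false ∷ v) = ∈-concatMap⁺ _ (lose (∈-allVecs v) (here refl))
∈-allVecs (true ∷ v)  = ∈-concatMap⁺ _ (lose (∈-allVecs v) (there (here refl)))

ideal⇒∈Ab : ∀ n {S} → IsAbelianIdeal n S → S ∈ Ab n
ideal⇒∈Ab n {S} ideal = ∈-filter⁺ (λ S → T? (isUpperIdeal n S ∧ isAbelian n S)) (∈-allVecs S) (∧-intro
  (∀⇒all _ λ k → ∀⇒all _ λ k′ → ⇒ᵇ-intro λ t →
    let k∈ , covers = ∧-elim {mem n k S} t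
        l , ok , eq = label n k
        l′ , ok′ , eq′ = label n k′
        k″ , eq″ , k″∈ = upper l l′ ok ok′ (k , eq , k∈)
          (subst IsSimple (cong₂ _-ʷ_ eq′ eq) (simpleRoot⇒IsSimple (any⇒∈ (simpleRoots n) covers)))
    in subst (λ k → T (mem n k S)) (root-injective k″ k′ (trans eq″ (sym eq′))) k″∈)
  (∀⇒all _ λ k → ∀⇒all _ λ k′ → ⇒ᵇ-intro λ t → not-intro λ sum∈ →
    let k∈ , k′∈ = ∧-elim {mem n k S} t
        l , ok , eq = label n k
        l′ , ok′ , eq′ = label n k′
    in abelian l l′ ok ok′ (k , eq , k∈) (k′ , eq′ , k′∈)
         (subst IsRoot (cong₂ _+ʷ_ eq eq′) (posRoot⇒IsRoot (any⇒∈ (posRoots n) sum∈)))))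
  where open IsAbelianIdeal ideal

-- Abelian ideals contain no root εᵢ - εⱼ

raise : ∀ {n} i j k → wt {n} (add i k) -ʷ wt (add j k) ≡ wt (dif i j)
raise i j k = +ʷ⇒-ʷ (trans (cong (_+ʷ e k) (sym (-ʷ+ʷ (e i) (e j)))) (+ʷ-assoc (e i -ʷ e j) (e j) (e k)))

raise′ : ∀ {n} i j k → wt {n} (add k i) -ʷ wt (add k j) ≡ wt (dif i j)
raise′ i j k = trans (cong₂ _-ʷ_ (+ʷ-comm (e k) (e i)) (+ʷ-comm (e k) (e j))) (raise i j k)

raise-dif : ∀ {n} i j k → wt {n} (dif k j) -ʷ wt (dif k i) ≡ wt (dif i j)
raise-dif i j k = +ʷ⇒-ʷ (+ʷ-cancelʳ _ _ (e j) (begin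
  (e k -ʷ e j) +ʷ e j                      ≡⟨ -ʷ+ʷ (e k) (e j) ⟩
  e k                                      ≡⟨ -ʷ+ʷ (e k) (e i) ⟨
  (e k -ʷ e i) +ʷ e i                      ≡⟨ cong ((e k -ʷ e i) +ʷ_) (-ʷ+ʷ (e i) (e j)) ⟨
  (e k -ʷ e i) +ʷ ((e i -ʷ e j) +ʷ e j)    ≡⟨ +ʷ-assoc (e k -ʷ e i) (e i -ʷ e j) (e j) ⟨
  ((e k -ʷ e i) +ʷ (e i -ʷ e j)) +ʷ e j    ≡⟨ cong (_+ʷ e j) (+ʷ-comm (e k -ʷ e i) (e i -ʷ e j)) ⟩
  ((e i -ʷ e j) +ʷ (e k -ʷ e i)) +ʷ e j    ∎))
  where open ≡-Reasoning

dif⇒add : ∀ {n} i j → wt {n} (add i j) -ʷ wt (dif i j) ≡ wt (add j j)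
dif⇒add i j = +ʷ⇒-ʷ (begin
  e i +ʷ e j                        ≡⟨ cong (_+ʷ e j) (-ʷ+ʷ (e i) (e j)) ⟨
  ((e i -ʷ e j) +ʷ e j) +ʷ e j      ≡⟨ +ʷ-assoc (e i -ʷ e j) (e j) (e j) ⟩
  (e i -ʷ e j) +ʷ (e j +ʷ e j)      ≡⟨ +ʷ-comm (e i -ʷ e j) (e j +ʷ e j) ⟩
  (e j +ʷ e j) +ʷ (e i -ʷ e j)      ∎)
  where open ≡-Reasoning

dif+add : ∀ {n} i j → wt {n} (dif i j) +ʷ wt (add i j) ≡ wt (add i i)
dif+add i j = begin
  (e i -ʷ e j) +ʷ (e i +ʷ e j)   ≡⟨ cong ((e i -ʷ e j) +ʷ_) (+ʷ-comm (e i) (e j)) ⟩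
  (e i -ʷ e j) +ʷ (e j +ʷ e i)   ≡⟨ +ʷ-assoc (e i -ʷ e j) (e j) (e i) ⟨
  ((e i -ʷ e j) +ʷ e j) +ʷ e i   ≡⟨ cong (_+ʷ e i) (-ʷ+ʷ (e i) (e j)) ⟩
  e i +ʷ e i                     ∎
  where open ≡-Reasoning

no-dif : ∀ {n S} a b → IsAbelianIdeal n S → Valid n (dif a b) → ¬ In n S (dif a b)
no-dif {suc n} {S} a b ideal (a<b , s≤s b≤n) in-dif =
  abelian (dif a n) (add a n) (a<n , ≤-refl) (<⇒≤ a<n , ≤-refl) (proj₂ top) in-add
    (add a a , (≤-refl , m≤n⇒m≤1+n a<n) , dif+add a n)
  where
  open IsAbelianIdeal ideal
  -- The rank is `suc n`, so `n` is the last index. Adding the simple roots ε_c - ε_{c+1} in turn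
  -- moves the second index from `b` up to it.
  climb : ∀ d → b + d ≤ n → a < b + d × In (suc n) S (dif a (b + d))
  climb zero    _ rewrite +-identityʳ b = a<b , in-dif
  climb (suc d) h rewrite +-suc b d with lt , inS ← climb d (<⇒≤ h) =
    m≤n⇒m≤1+n lt ,
    upper (dif a (b + d)) (dif a (suc (b + d))) (lt , m≤n⇒m≤1+n h) (m≤n⇒m≤1+n lt , s≤s h) inS
      (step (b + d) (s≤s h) (raise-dif (b + d) (suc (b + d)) a))
  top : a < n × In (suc n) S (dif a n)
  top = subst (λ c → a < c × In (suc n) S (dif a c)) (m+[n∸m]≡n b≤n) (climb (n ∸ b) (≤-reflexive (m+[n∸m]≡n b≤n)))
  a<n = proj₁ top
  in-add : In (suc n) S (add a n)
  in-add = upper (dif a n) (add a n) (a<n , ≤-refl) (<⇒≤ a<n , ≤-refl) (proj₂ top) (last n refl (dif⇒add a n))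

-- The abelian ideal below a path

-- Below a lattice path, on the diagonal j − i = n − m, lie the roots εᵢ + εⱼ with i < height m.
below : ∀ {n} → Vec Bool n → Label → Bool
below         b (dif _ _) = false
below {n = n} b (add i j) = i <ᵇ height b (n ∸ (j ∸ i))

idealOf : ∀ {n} → Vec Bool n → SubΔ n
idealOf {n} b = V.tabulate (λ k → below b (proj₁ (label n k)))

-- `idealOf` uses the label that `label n k` happens to produce; since labels are unique, membership
-- can be read off any valid label of the root.
mem-idealOf : ∀ {n} (b : Vec Bool n) l k → Valid n l → root n k ≡ wt l → mem n k (idealOf b) ≡ below b l
mem-idealOf {n} b l k ok eq with label n k | V.lookup∘tabulate (λ k → below b (proj₁ (label n k))) k
... | l′ , ok′ , eq′ | p with refl ← wt-injective l l′ ok ok′ (trans (sym eq) eq′) = p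

In-idealOf : ∀ {n} (b : Vec Bool n) l → Valid n l → In n (idealOf b) l ⇔ T (below b l)
In-idealOf {n} b l ok = mk⇔ (λ (k , eq , k∈) → subst T (mem-idealOf b l k ok eq) k∈)
  (λ t → let k , eq = index n l ok in k , eq , subst T (sym (mem-idealOf b l k ok eq)) t)

diag-suc : ∀ {n d} → d < n → n ∸ d ≡ suc (n ∸ suc d)
diag-suc {suc n} {zero}  _         = refl
diag-suc {suc n} {suc d} (s≤s d<n) = diag-suc d<n

gap-suc : ∀ {i j} → i < j → j ∸ i ≡ suc (j ∸ suc i)
gap-suc = diag-suc

-- Lowering the first index lengthens the gap j - i, so the height is taken one step earlier, where
-- it is smaller by at most 1; the index itself fell by 1. In `below-step₂` the height is taken one
-- step later, where it is no smaller.
below-step₁ : ∀ {n} (b : Vec Bool n) {i j} → suc i ≤ j → j < n → T (below b (add (suc i) j)) → T (below b (add i j))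
below-step₁ {n} b {i} {j} i<j j<n t rewrite gap-suc i<j =
  <⇒<ᵇ (≤-pred (≤-trans (<ᵇ⇒< (suc i) _ t)
    (subst (λ m → height b m ≤ suc (height b (n ∸ suc (j ∸ suc i)))) (sym (diag-suc (≤-<-trans (m∸n≤m j (suc i)) j<n)))
      (height-suc≤ b _))))

below-step₂ : ∀ {n} (b : Vec Bool n) {i j} → i ≤ j → suc j < n → T (below b (add i (suc j))) → T (below b (add i j))
below-step₂ {n} b {i} {j} i≤j j<n t rewrite +-∸-assoc 1 i≤j =
  <⇒<ᵇ (≤-trans (<ᵇ⇒< i _ t)
    (subst (λ m → height b (n ∸ suc (j ∸ i)) ≤ height b m) (sym (diag-suc (≤-<-trans (m∸n≤m j i) (<-trans (n<1+n j) j<n))))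
      (height-mono-suc b _)))

-- `total` excludes differences. For `l = add k l′` the equation reads e_k + e_{l′} + e_{a+1} = e_i
-- + e_j + e_a, and coordinate a + 1 forces a + 1 to be i or j.
simple-above-add : ∀ {n i j a} l → Valid n l → Valid n (add i j) → suc a < n →
  wt {n} l -ʷ wt (add i j) ≡ wt (dif a (suc a)) → (suc a ≡ i × l ≡ add a j) ⊎ (suc a ≡ j × i ≤ a × l ≡ add i a)
simple-above-add {n} {i} {j} {a} l ok (i≤j , j<n) a+1<n eq = go l ok eq
  where
  a<n = <-trans (n<1+n a) a+1<n
  first : ∀ {k l} → k ≤ l → l < n → suc a ≡ i → _≡_ {A = Wt n} ((e k +ʷ e l) +ʷ e (suc a)) ((e i +ʷ e j) +ʷ e a) →
    add k l ≡ add a j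
  first {k} {l} k≤l l<n refl sums = cong₂ add (proj₁ kl) (proj₂ kl)
    where
    kl = e+e-injective k≤l l<n (<⇒≤ i≤j) j<n (+ʷ-cancelʳ _ _ (e (suc a)) (begin
      (e k +ʷ e l) +ʷ e (suc a)   ≡⟨ sums ⟩
      (e (suc a) +ʷ e j) +ʷ e a   ≡⟨ +ʷ-assoc (e (suc a)) (e j) (e a) ⟩
      e (suc a) +ʷ (e j +ʷ e a)   ≡⟨ +ʷ-comm (e (suc a)) (e j +ʷ e a) ⟩
      (e j +ʷ e a) +ʷ e (suc a)   ≡⟨ cong (_+ʷ e (suc a)) (+ʷ-comm (e j) (e a)) ⟩
      (e a +ʷ e j) +ʷ e (suc a)   ∎))
      where open ≡-Reasoning
  go : ∀ l → Valid n l → wt {n} l -ʷ wt (add i j) ≡ wt (dif a (suc a)) →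
    (suc a ≡ i × l ≡ add a j) ⊎ (suc a ≡ j × i ≤ a × l ≡ add i a)
  go (dif k l) ok eq with () ← trans (sym (total-wt (dif k l) ok)) (trans (cong total (-ʷ⇒+ʷ eq))
    (trans (total-+ʷ {n} (wt (dif a (suc a))) (wt (add i j)))
      (cong₂ ℤ._+_ (total-wt (dif a (suc a)) (n<1+n a , a+1<n)) (total-wt (add i j) (i≤j , j<n)))))
  go (add k l) (k≤l , l<n) eq with sums ← -ʷ≡-ʷ⇒+ʷ≡+ʷ eq | e+e+e-split i j a k l (suc a) a+1<n (-ʷ≡-ʷ⇒+ʷ≡+ʷ eq)
  ... | inj₁ a+1≡i = inj₁ (a+1≡i , first k≤l l<n a+1≡i sums)
  ... | inj₂ (inj₂ a+1≡a) = ⊥-elim (1+n≢n a+1≡a)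
  ... | inj₂ (inj₁ a+1≡j) with m≤n⇒m<n∨m≡n i≤j
  -- On the long root both indices are a + 1. The result belongs to the first alternative, because
  -- `add i a` would have its indices out of order.
  ...   | inj₂ i≡j = inj₁ (a+1≡i , first k≤l l<n a+1≡i sums)
    where a+1≡i = trans a+1≡j (sym i≡j)
  go (add k l) (k≤l , l<n) eq | inj₂ (inj₁ refl) | inj₁ (s≤s i≤a) = inj₂ (refl , i≤a , cong₂ add (proj₁ kl) (proj₂ kl))
    where
    kl = e+e-injective k≤l l<n i≤a a<n (+ʷ-cancelʳ _ _ (e (suc a))
      (trans (-ʷ≡-ʷ⇒+ʷ≡+ʷ eq) (+ʷ-swapʳ (e i) (e (suc a)) (e a))))

-- Any two roots εᵢ + εⱼ have sum of degree 4. So no such sum is a root, which makes these ideals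
-- abelian, and adding 2εₙ never leads upwards from one of them.
degree≢4 : ∀ l → degree l ≢ + 4
degree≢4 (dif _ _) ()
degree≢4 (add _ _) ()

idealOf-isAbelianIdeal : ∀ {n} (b : Vec Bool n) → IsAbelianIdeal n (idealOf b)
idealOf-isAbelianIdeal {n} b = record { upper = upper ; abelian = abelian }
  where
  upper : ∀ l l′ → Valid n l → Valid n l′ → In n (idealOf b) l → IsSimple (wt {n} l′ -ʷ wt l) → In n (idealOf b) l′
  upper (dif a c) _ ok ok′ inS _ = ⊥-elim (Equivalence.to (In-idealOf b (dif a c) ok) inS)
  upper (add i j) l′ ok@(i≤j , j<n) ok′ inS (step a a+1<n eq)
    with t ← Equivalence.to (In-idealOf b (add i j) ok) inS | simple-above-add l′ ok′ ok a+1<n eq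
  ... | inj₁ (refl , refl) = Equivalence.from (In-idealOf b (add a j) ok′) (below-step₁ b i≤j j<n t)
  ... | inj₂ (refl , i≤a , refl) = Equivalence.from (In-idealOf b (add i a) ok′) (below-step₂ b i≤a j<n t)
  upper (add i j) l′ ok ok′ inS (last a refl eq) = ⊥-elim (degree≢4 l′ (begin
    degree l′                                              ≡⟨ total-wt l′ ok′ ⟨
    total {n} (wt l′)                                      ≡⟨ cong total (-ʷ⇒+ʷ eq) ⟩
    total {n} (wt (add a a) +ʷ wt (add i j))               ≡⟨ total-+ʷ {n} (wt (add a a)) (wt (add i j)) ⟩
    total {n} (wt (add a a)) ℤ.+ total {n} (wt (add i j))
      ≡⟨ cong₂ ℤ._+_ (total-wt (add a a) (≤-refl , n<1+n a)) (total-wt (add i j) ok) ⟩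
    + 4 ∎))
    where open ≡-Reasoning

  abelian : ∀ l l′ → Valid n l → Valid n l′ → In n (idealOf b) l → In n (idealOf b) l′ → ¬ IsRoot (wt {n} l +ʷ wt l′)
  abelian (dif a c) l′ ok ok′ inS _ _ = Equivalence.to (In-idealOf b (dif a c) ok) inS
  abelian (add i j) (dif a c) ok ok′ _ inS _ = Equivalence.to (In-idealOf b (dif a c) ok′) inS
  abelian (add i j) (add i′ j′) ok ok′ _ _ (l , okˡ , eq) = degree≢4 l (begin
    degree l                                                 ≡⟨ total-wt l okˡ ⟨
    total {n} (wt l)                                         ≡⟨ cong total eq ⟨
    total {n} (wt (add i j) +ʷ wt (add i′ j′))               ≡⟨ total-+ʷ {n} (wt (add i j)) (wt (add i′ j′)) ⟩
    total {n} (wt (add i j)) ℤ.+ total {n} (wt (add i′ j′))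
      ≡⟨ cong₂ ℤ._+_ (total-wt (add i j) ok) (total-wt (add i′ j′) ok′) ⟩
    + 4 ∎)
    where open ≡-Reasoning

≡idealOf : ∀ {n S} {b : Vec Bool n} → (∀ l → Valid n l → In n S l ⇔ T (below b l)) → S ≡ idealOf b
≡idealOf {n} {S} {b} h = trans (sym (V.tabulate∘lookup S)) (V.tabulate-cong λ k →
  let l , ok , eq = label n k in agree k l eq (h l ok))
  where
  agree : ∀ k l → root n k ≡ wt l → In n S l ⇔ T (below b l) → V.lookup S k ≡ below b l
  agree k l eq l∈ = T-ext (λ k∈ → Equivalence.to l∈ (k , eq , k∈)) (λ t →
    let k′ , eq′ , k′∈ = Equivalence.from l∈ t
    in subst (λ k → T (V.lookup S k)) (root-injective k′ k (trans eq′ (sym eq))) k′∈)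

-- Every abelian ideal lies below a path

cellLabel : ℕ → ℕ → ℕ → Label
cellLabel n m i = add i (i + (n ∸ m))

cellLabel-valid : ∀ {n m i} → m ≤ n → i < m → Valid n (cellLabel n m i)
cellLabel-valid {n} {m} {i} m≤n i<m =
  m≤m+n i (n ∸ m) , ≤-trans (+-monoˡ-≤ (n ∸ m) i<m) (≤-reflexive (m+[n∸m]≡n m≤n))

diag-shift : ∀ {n m} i → m < n → i + (n ∸ m) ≡ suc (i + (n ∸ suc m))
diag-shift i m<n = trans (cong (λ d → i + d) (diag-suc m<n)) (+-suc i _)

module _ {n : ℕ} {S : SubΔ n} (ideal : IsAbelianIdeal n S) where
  open IsAbelianIdeal ideal

  -- Adding ε_c - ε_{c+1} lowers the second index and so raises m. In `cell-down`, adding εᵢ - εᵢ₊₁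
  -- lowers the first index, and i and m fall together. These are the two closure conditions of
  -- `triangle⇒height`.
  cell-up : ∀ {m i} → m < n → i < m → In n S (cellLabel n m i) → In n S (cellLabel n (suc m) i)
  cell-up {m} {i} m<n i<m inS = upper (add i (suc c)) (add i c)
    ok (cellLabel-valid m<n (m≤n⇒m≤1+n i<m)) (subst (In n S ∘ add i) c+1 inS)
    (step c (proj₂ ok) (raise′ c (suc c) i))
    where
    c = i + (n ∸ suc m)
    c+1 = diag-shift i m<n
    ok : Valid n (add i (suc c))
    ok = subst (Valid n ∘ add i) c+1 (cellLabel-valid (<⇒≤ m<n) i<m)

  cell-down : ∀ {m i} → m < n → i < m → In n S (cellLabel n (suc m) (suc i)) → In n S (cellLabel n m i)
  cell-down {m} {i} m<n i<m inS = subst (In n S ∘ add i) (sym c+1) (upper (add (suc i) (suc c)) (add i (suc c))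
    (cellLabel-valid m<n (s≤s i<m)) (subst (Valid n ∘ add i) c+1 (cellLabel-valid (<⇒≤ m<n) i<m)) inS
    (step i (≤-trans (s≤s i<m) m<n) (raise i (suc i) (suc c))))
    where
    c = i + (n ∸ suc m)
    c+1 = diag-shift i m<n

  -- The conjunct `i < m` restricts to the triangle: it gives the first hypothesis of
  -- `triangle⇒height` at once and makes `cellLabel n m i` valid for m ≤ n.
  cell? : ∀ m i → Dec (i < m × In n S (cellLabel n m i))
  cell? m i = (i <? m) ×-dec In? n S (cellLabel n m i)

  ideal⇒path : ∃ λ (b : Vec Bool n) → ∀ {m i} → m ≤ n → T ⌊ cell? m i ⌋ ⇔ i < height b m
  ideal⇒path = triangle⇒height n (λ m i → ⌊ cell? m i ⌋)
    (λ {m} {i} _ q → proj₁ (toWitness {a? = cell? m i} q))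
    (λ {m} {i} m<n q → let i<m , inS = toWitness {a? = cell? m i} q in
      fromWitness {a? = cell? (suc m) i} (m≤n⇒m≤1+n i<m , cell-up m<n i<m inS))
    (λ {m} {i} m<n q → let i<m , inS = toWitness {a? = cell? (suc m) (suc i)} q in
      fromWitness {a? = cell? m i} (≤-pred i<m , cell-down m<n (≤-pred i<m) inS))

  idealOf-surjective : ∃ λ b → S ≡ idealOf b
  idealOf-surjective with b , path ← ideal⇒path = b , ≡idealOf λ
    { (dif a c) ok → mk⇔ (λ inS → no-dif a c ideal ok inS) λ ()
    ; (add i j) ok → add-agree b path ok }
    where
    add-agree : ∀ b → (∀ {m i} → m ≤ n → T ⌊ cell? m i ⌋ ⇔ i < height b m) →
      ∀ {i j} → Valid n (add i j) → In n S (add i j) ⇔ T (below b (add i j))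
    add-agree b path {i} {j} (i≤j , j<n) = mk⇔
      (λ inS → <⇒<ᵇ (Equivalence.to (path {m} {i} m≤n)
        (fromWitness {a? = cell? m i} (i<m , subst (In n S ∘ add i) j≡ inS))))
      (λ t → subst (In n S ∘ add i) (sym j≡)
        (proj₂ (toWitness {a? = cell? m i} (Equivalence.from (path {m} {i} m≤n) (<ᵇ⇒< i _ t)))))
      where
      m = n ∸ (j ∸ i)
      m≤n = m∸n≤m n (j ∸ i)
      j≡ : j ≡ i + (n ∸ m)
      j≡ = sym (trans (cong (λ d → i + d) (m∸[m∸n]≡n (≤-trans (m∸n≤m j i) (<⇒≤ j<n)))) (m+[n∸m]≡n i≤j))
      i<m : i < m
      i<m = m+n≤o⇒m≤o∸n (suc i) (subst (_≤ n) (cong suc (sym (m+[n∸m]≡n i≤j))) j<n)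

-- Inclusion and covers of ideals in terms of paths

height-≥ : ∀ {n} (b : Vec Bool n) {m} → n ≤ m → height b m ≡ height b n
height-≥ []      _         = refl
height-≥ (x ∷ b) (s≤s n≤m) = cong (λ h → bit x + h) (height-≥ b n≤m)

<-closed⇒≤ : ∀ {x y} → (∀ i → i < x → i < y) → x ≤ y
<-closed⇒≤ {zero}  h = z≤n
<-closed⇒≤ {suc x} h = h x ≤-refl

incl⇔⊑ : ∀ {n} (c b : Vec Bool n) → T (incl n (idealOf c) (idealOf b)) ⇔ c ⊑ b
incl⇔⊑ {n} c b = mk⇔ to from
  where
  -- Each `i < height c m` is a root on the diagonal of `m` and lies in the ideal of `c`, hence in
  -- that of `b`; this gives `i < height b m`.
  within : T (incl n (idealOf c) (idealOf b)) → ∀ m → m ≤ n → height c m ≤ height b m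
  within t m m≤n = <-closed⇒≤ λ i i<h →
    let i<m = ≤-trans i<h (height≤ c m)
        l = cellLabel n m i
        ok = cellLabel-valid m≤n i<m
        m≡ = trans (cong (n ∸_) (m+n∸m≡n i (n ∸ m))) (m∸[m∸n]≡n m≤n)
        k , eq = index n l ok
        k∈c = subst T (sym (mem-idealOf c l k ok eq)) (<⇒<ᵇ (subst (λ m → i < height c m) (sym m≡) i<h))
        k∈b = ⇒ᵇ-elim (all⇒∀ _ t k) k∈c
    in subst (λ m → i < height b m) m≡ (<ᵇ⇒< i _ (subst T (mem-idealOf b l k ok eq) k∈b))
  to : T (incl n (idealOf c) (idealOf b)) → c ⊑ b
  to t m with ≤-total m n
  ... | inj₁ m≤n = within t m m≤n
  -- No diagonal corresponds to m > n, but there both heights have their value at `n`.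
  ... | inj₂ n≤m rewrite height-≥ c n≤m | height-≥ b n≤m = within t n ≤-refl
  from : c ⊑ b → T (incl n (idealOf c) (idealOf b))
  from c⊑b = ∀⇒all _ λ k → ⇒ᵇ-intro λ k∈ →
    let l , ok , eq = label n k
    in subst T (sym (mem-idealOf b l k ok eq)) (mono l (subst T (mem-idealOf c l k ok eq) k∈))
    where
    mono : ∀ l → T (below c l) → T (below b l)
    mono (add i j) t = <⇒<ᵇ (≤-trans (<ᵇ⇒< i _ t) (c⊑b _))

strictIncl⇔ : ∀ {n} (c b : Vec Bool n) → T (strictIncl n (idealOf c) (idealOf b)) ⇔ (c ⊑ b × c ≢ b)
strictIncl⇔ {n} c b = mk⇔
  (λ t → let c⊆b , b⊈c = ∧-elim {incl n (idealOf c) (idealOf b)} t in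
    Equivalence.to (incl⇔⊑ c b) c⊆b , λ { refl → not-elim b⊈c (Equivalence.from (incl⇔⊑ c c) (λ _ → ≤-refl)) })
  (λ (c⊑b , c≢b) → ∧-intro (Equivalence.from (incl⇔⊑ c b) c⊑b)
    (not-intro λ b⊆c → c≢b (⊑-antisym c⊑b (Equivalence.to (incl⇔⊑ b c) b⊆c))))

Ab-idealOf : ∀ n (b : Vec Bool n) → idealOf b ∈ Ab n
Ab-idealOf n b = ideal⇒∈Ab n (idealOf-isAbelianIdeal b)

infix 4 _⊏_
_⊏_ : ∀ {n} → Vec Bool n → Vec Bool n → Set
c ⊏ b = c ⊑ b × c ≢ b

∈Ab⇒idealOf : ∀ n {S} → S ∈ Ab n → ∃ λ (b : Vec Bool n) → S ≡ idealOf b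
∈Ab⇒idealOf n {S} S∈ = idealOf-surjective {n} {S} (∈Ab⇒ideal n {S} S∈)

any-Ab⁺ : ∀ n p (b : Vec Bool n) → T (p (idealOf b)) → T (any p (Ab n))
any-Ab⁺ n p b pb = any⁺ {xs = Ab n} p (lose (Ab-idealOf n b) pb)

any-Ab⁻ : ∀ n p → T (any p (Ab n)) → ∃ λ (b : Vec Bool n) → T (p (idealOf b))
any-Ab⁻ n p t = go (find (any⁻ p (Ab n) t))
  where
  go : (∃ λ S → S ∈ Ab n × T (p S)) → ∃ λ b → T (p (idealOf b))
  go (S , S∈ , pS) = proj₁ (∈Ab⇒idealOf n S∈) , subst (T ∘ p) (proj₂ (∈Ab⇒idealOf n S∈)) pS

coveredBy⇔ : ∀ {n} (c b : Vec Bool n) →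
  T (coveredBy n (idealOf c) (idealOf b)) ⇔ (c ⊏ b × ∀ z → c ⊏ z → ¬ z ⊏ b)
coveredBy⇔ {n} c b = mk⇔
  (λ t → let c⊂b , none = ∧-elim {strictIncl n (idealOf c) (idealOf b)} t in
    Equivalence.to (strictIncl⇔ c b) c⊂b ,
    λ z c⊏z z⊏b → not-elim none (any-Ab⁺ n between z
      (∧-intro (Equivalence.from (strictIncl⇔ c z) c⊏z) (Equivalence.from (strictIncl⇔ z b) z⊏b))))
  (λ (c⊏b , none) → ∧-intro (Equivalence.from (strictIncl⇔ c b) c⊏b) (not-intro λ t →
    let z , t′ = any-Ab⁻ n between t
        c⊂z , z⊂b = ∧-elim {strictIncl n (idealOf c) (idealOf z)} t′
    in none z (Equivalence.to (strictIncl⇔ c z) c⊂z) (Equivalence.to (strictIncl⇔ z b) z⊂b)))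
  where
  between : SubΔ n → Bool
  between z = strictIncl n (idealOf c) z ∧ strictIncl n z (idealOf b)

-- The path `z` that `⊏⇒cov` supplies just under `b` would lie strictly between unless it is `c`
-- itself. Conversely `cov-between` leaves no room.
cov⇔ : ∀ {n} (c b : Vec Bool n) → (c ⊏ b × ∀ z → c ⊏ z → ¬ z ⊏ b) ⇔ T (cov c b)
cov⇔ c b = mk⇔ to from
  where
  to : (c ⊏ b × ∀ z → c ⊏ z → ¬ z ⊏ b) → T (cov c b)
  to ((c⊑b , c≢b) , none) with z , z⋖b , c⊑z ← ⊏⇒cov c b c⊑b c≢b with T? (eqVec c z)
  ... | yes c≡z rewrite eqVec⇒≡ c z c≡z = z⋖b
  ... | no c≢z = ⊥-elim (none z (c⊑z , λ { refl → c≢z (eqVec-refl c) }) (cov⇒⊑ z b z⋖b , cov⇒≢ z b z⋖b))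
  from : T (cov c b) → c ⊏ b × ∀ z → c ⊏ z → ¬ z ⊏ b
  from c⋖b = (cov⇒⊑ c b c⋖b , cov⇒≢ c b c⋖b) , λ z (c⊑z , c≢z) (z⊑b , z≢b) →
    Sum.[ c≢z ∘ sym , z≢b ] (cov-between c b z c⋖b c⊑z z⊑b)

coveredBy≡cov : ∀ {n} (c b : Vec Bool n) → coveredBy n (idealOf c) (idealOf b) ≡ cov c b
coveredBy≡cov c b = T-ext (Equivalence.to (cov⇔ c b) ∘ Equivalence.to (coveredBy⇔ c b))
                          (Equivalence.from (coveredBy⇔ c b) ∘ Equivalence.from (cov⇔ c b))

-- Transfer of the counts from ideals to paths

allVecs-unique : ∀ m → Unique (allVecs m)
allVecs-unique zero    = All.[] ∷ []
allVecs-unique (suc m) = concatMap-unique (allVecs-unique m)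
  (λ v → ((λ ()) All.∷ All.[]) ∷ All.[] ∷ [])
  λ { (here refl) (here refl) → refl ; (there (here refl)) (there (here refl)) → refl
    ; (here refl) (there (here ())) ; (there (here refl)) (here ()) }

idealOf-injective : ∀ {n} {c b : Vec Bool n} → idealOf c ≡ idealOf b → c ≡ b
idealOf-injective {n} {c} {b} eq = ⊑-antisym
  (Equivalence.to (incl⇔⊑ c b) (subst (λ S → T (incl n (idealOf c) S)) eq (Equivalence.from (incl⇔⊑ c c) (λ _ → ≤-refl))))
  (Equivalence.to (incl⇔⊑ b c) (subst (λ S → T (incl n S (idealOf c))) eq (Equivalence.from (incl⇔⊑ c c) (λ _ → ≤-refl))))

-- The two lists have the same elements and no repetitions, so they agree up to order, which is all
-- that counting sees.
Ab↭ : ∀ n → Ab n ↭ L.map idealOf (allVecs n)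
Ab↭ n = ∼bag⇒↭ (unique∧set⇒bag
  (Unique.filter⁺ (λ S → T? (isUpperIdeal n S ∧ isAbelian n S)) (allVecs-unique (N n)))
  (Unique.map⁺ idealOf-injective (allVecs-unique n))
  (mk⇔ (λ S∈ → let b , S≡ = ∈Ab⇒idealOf n S∈ in
          subst (_∈ L.map idealOf (allVecs n)) (sym S≡) (∈-map⁺ idealOf (∈-allVecs b)))
       (λ S∈ → let b , _ , S≡ = ∈-map⁻ idealOf S∈ in subst (_∈ Ab n) (sym S≡) (Ab-idealOf n b))))

countᵇ-Ab : ∀ n (p : SubΔ n → Bool) → countᵇ p (Ab n) ≡ countᵇ (p ∘ idealOf) (allVecs n)
countᵇ-Ab n p = trans (↭-length (filter-↭ (λ S → T? (p S)) (Ab↭ n))) (countᵇ-map p idealOf (allVecs n))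

κ-idealOf : ∀ {n} (b : Vec Bool n) → κ n (idealOf b) ≡ runs b
κ-idealOf {n} b = trans (countᵇ-Ab n (λ y → coveredBy n y (idealOf b)))
  (trans (countᵇ-cong (λ c → coveredBy≡cov c b) (allVecs n)) (countᵇ-cov b))

ι-idealOf : ∀ {n} (b : Vec Bool n) → ι n (idealOf b) ≡ runs (V.map not b)
ι-idealOf {n} b = trans (countᵇ-Ab n (λ y → coveredBy n (idealOf b) y))
  (trans (countᵇ-cong (coveredBy≡cov b) (allVecs n)) (countᵇ-cov-above b))

theorem5p2 : (n : ℕ) → 1 ≤ n → (k : ℕ) →
    (Kᵘ-coeff n k ≡ suc n C (2 * k)) × (Kˡ-coeff n k ≡ suc n C (2 * k))
theorem5p2 n _ k =
  trans (countᵇ-Ab n (λ x → κ n x ≡ᵇ k))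
    (trans (countᵇ-cong (λ b → cong (_≡ᵇ k) (κ-idealOf b)) (allVecs n)) (countᵇ-runs n k)) ,
  trans (countᵇ-Ab n (λ x → ι n x ≡ᵇ k))
    (trans (countᵇ-cong (λ b → cong (_≡ᵇ k) (ι-idealOf b)) (allVecs n)) (countᵇ-runs-not n k))
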